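{- Let $s,t\geq 1$ be integers and let $p,q,l$ be three distinct primes with $p,q$ odd, $p\equiv 3 \pmod 4$, $\mathrm{ord}_{p^s}(l)=\phi(p^s)/2$, $\mathrm{ord}_{q^t}(l)=\phi(q^t)$ and $\gcd(\phi(p^s),\phi(q^t))=2$. Let $0\leq i<i'\leq s-1$ and $0\leq j<j'\leq t$. Then in the ring $\mathbb{F}_l[x]/\langle x^{p^sq^t}-1\rangle$: (i) $\chi_{ij}\chi_{i'j'}=\chi_{ij}\chi_{i'j'}^*=\frac{\phi(p^{s-i'})}{2}\phi(q^{t-j'})\chi_{ij}$. (ii) $\chi_{ij}^*\chi_{i'j'}=\chi_{ij}^*\chi_{i'j'}^*=\frac{\phi(p^{s-i'})}{2}\phi(q^{t-j'})\chi_{ij}^*$.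
   Context: Here $\phi$ is Euler's phi function (with $\phi(1)=1$) and $\mathrm{ord}_m(k)$ is the multiplicative order of $k$ modulo $m$. Put $n=p^sq^t$. Fix an integer $g$ that is a primitive root both modulo $p^s$ and modulo $q^t$. For an integer $\gamma$, $C_\gamma=\{\gamma l^r \bmod n: r\geq 0\}\subseteq \mathbb{Z}_n$ is the $l$-cyclotomic coset modulo $n$ containing $\gamma$. For $0\leq i\leq s$, $0\leq j\leq t$ set $C_{ij}=C_{p^iq^j}$ and $C_{ij}^*=C_{p^iq^jg}$. Define elements of $\mathbb{F}_l[x]/\langle x^{n}-1\rangle$ by $\chi_{ij}=\sum_{\alpha\in C_{ij}}x^\alpha$ and $\chi_{ij}^*=\sum_{\alpha\in C_{ij}^*}x^\alpha$. Integer coefficients are read in $\mathbb{F}_l$. -}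

module Defs where

open import Algebra.Bundles using (CommutativeRing)
open import Algebra.Definitions.RawMagma using (_,_)
import Algebra.Properties.CommutativeSemigroup as CommutativeSemigroupProperties
import Algebra.Properties.Ring as RingProperties
import Algebra.Properties.Semiring.Divisibility as Divisibility
import Algebra.Properties.Semiring.Exp as Exp
open import Data.Fin.Base using (Fin; toℕ; fromℕ<)
open import Data.Fin.Properties using (pigeonhole; fromℕ<-injective; toℕ<n)
open import Data.Integer.Base as ℤ using (ℤ; +_)
open import Data.Integer.DivMod using (_%ℕ_; _/ℕ_; n%ℕd<d; a≡a%ℕn+[a/ℕn]*n)
import Data.Integer.Divisibility.Signed as Signed
import Data.Integer.Properties as ℤₚ
open import Data.List.Base
  using (List; []; _∷_; map; foldr; filter; length; allFin; applyUpTo)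
open import Data.Nat.Base as ℕ using (ℕ; zero; suc)
open import Data.Nat.Coprimality using (coprime?)
open import Data.Nat.Induction using (<-rec)
import Data.Nat.Properties as ℕₚ
open import Data.Product.Base using (∃; _×_; _,_)
open import Level using (_⊔_; 0ℓ)
open import Relation.Binary.Core using (Rel)
open import Relation.Binary.PropositionalEquality as ≡ using (_≡_)
open import Relation.Nullary.Decidable using (Dec; yes; no; map′)
open import Relation.Unary using (Pred; Decidable)

module _ {c ℓ} (R : CommutativeRing c ℓ) (a : CommutativeRing.Carrier R) where
  open CommutativeRing R
  open Divisibility semiring using (_∣_)

  infix 4 _≈/_
  _≈/_ : Rel Carrier (c ⊔ ℓ)
  x ≈/ y = a ∣ (x - y)

  private
    open RingProperties ring using (-‿distribˡ-*; -‿distribʳ-*; -‿+-comm; -‿involutive)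
    open CommutativeSemigroupProperties +-commutativeSemigroup using (interchange)

    trans-lemma : ∀ x y z → (x - y) + (y - z) ≈ x - z
    trans-lemma x y z =
      trans (+-assoc x (- y) (y - z)) (+-congˡ
      (trans (sym (+-assoc (- y) y (- z)))
      (trans (+-congʳ (-‿inverseˡ y)) (+-identityˡ (- z)))))

    -‿lemma : ∀ x y → - (x - y) ≈ - x - - y
    -‿lemma x y = sym (-‿+-comm x (- y))

    sym-lemma : ∀ x y → - (x - y) ≈ y - x
    sym-lemma x y =
      trans (-‿lemma x y) (trans (+-congˡ (-‿involutive y)) (+-comm (- x) y))

    neg-lemma : ∀ q u → - q * u ≈ - (q * u)
    neg-lemma q u = sym (-‿distribˡ-* q u)

    +-lemma : ∀ x y u v → (x - y) + (u - v) ≈ (x + u) - (y + v)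
    +-lemma x y u v = trans (interchange x (- y) u (- v)) (+-congˡ (-‿+-comm y v))

    *-lemma₁ : ∀ q r u y w → (q * u + y * r) * w ≈ (q * w) * u + y * (r * w)
    *-lemma₁ q r u y w = trans (distribʳ w (q * u) (y * r)) (+-cong
      (trans (*-assoc q u w) (trans (*-congˡ (*-comm u w)) (sym (*-assoc q w u))))
      (*-assoc y r w))

    *-lemma₂ : ∀ x y u v → (x - y) * u + y * (u - v) ≈ x * u - y * v
    *-lemma₂ x y u v = trans (+-cong
      (trans (distribʳ u x (- y)) (+-congˡ (sym (-‿distribˡ-* y u))))
      (trans (distribˡ y u (- v)) (+-congˡ (sym (-‿distribʳ-* y v)))))
      (trans-lemma (x * u) (y * u) (y * v))

    lift : ∀ {x y} → x ≈ y → x ≈/ y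
    lift {x} {y} x≈y = 0# , trans (zeroˡ a) (trans (sym (-‿inverseʳ y)) (+-congʳ (sym x≈y)))

  infixl 7 _/⟨_⟩
  _/⟨_⟩ : CommutativeRing c (c ⊔ ℓ)
  _/⟨_⟩ = record
    { Carrier = Carrier
    ; _≈_     = _≈/_
    ; _+_     = _+_
    ; _*_     = _*_
    ; -_      = -_
    ; 0#      = 0#
    ; 1#      = 1#
    ; isCommutativeRing = record
      { isRing = record
        { +-isAbelianGroup = record
          { isGroup = record
            { isMonoid = record
              { isSemigroup = record
                { isMagma = record
                  { isEquivalence = record
                    { refl  = lift refl
                    ; sym   = λ { {x} {y} (q , e) → - q ,
                        trans (neg-lemma q a) (trans (-‿cong e) (sym-lemma x y)) }
                    ; trans = λ { {x} {y} {z} (q , e) (r , f) → q + r ,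
                        trans (distribʳ a q r) (trans (+-cong e f) (trans-lemma x y z)) }
                    }
                  ; ∙-cong = λ { {x} {y} {u} {v} (q , e) (r , f) → q + r ,
                      trans (distribʳ a q r) (trans (+-cong e f) (+-lemma x y u v)) }
                  }
                ; assoc = λ x y z → lift (+-assoc x y z)
                }
              ; identity = (λ x → lift (+-identityˡ x)) , (λ x → lift (+-identityʳ x))
              }
            ; inverse = (λ x → lift (-‿inverseˡ x)) , (λ x → lift (-‿inverseʳ x))
            ; ⁻¹-cong = λ { {x} {y} (q , e) → - q ,
                trans (neg-lemma q a) (trans (-‿cong e) (-‿lemma x y)) }
            }
          ; comm = λ x y → lift (+-comm x y)
          }
        ; *-cong = λ { {x} {y} {u} {v} (q , e) (r , f) → q * u + y * r ,
            trans (*-lemma₁ q r u y a)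
              (trans (+-cong (*-congʳ e) (*-congˡ f)) (*-lemma₂ x y u v)) }
        ; *-assoc    = λ x y z → lift (*-assoc x y z)
        ; *-identity = (λ x → lift (*-identityˡ x)) , (λ x → lift (*-identityʳ x))
        ; distrib    = (λ x y z → lift (distribˡ x y z)) , (λ x y z → lift (distribʳ x y z))
        }
      ; *-comm = λ x y → lift (*-comm x y)
      }
    }

-- A polynomial is its list of coefficients, constant term first.  Trailing
-- zeros are allowed: equality compares all coefficients.

module Polynomial {c ℓ} (R : CommutativeRing c ℓ) where
  open CommutativeRing R

  Poly : Set c
  Poly = List Carrier

  coeff : Poly → ℕ → Carrier
  coeff []      _       = 0#
  coeff (a ∷ p) zero    = a
  coeff (a ∷ p) (suc k) = coeff p k

  infix 4 _≈ₚ_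
  _≈ₚ_ : Rel Poly ℓ
  p ≈ₚ q = ∀ k → coeff p k ≈ coeff q k

  infixl 6 _+ₚ_
  _+ₚ_ : Poly → Poly → Poly
  []      +ₚ q       = q
  (a ∷ p) +ₚ []      = a ∷ p
  (a ∷ p) +ₚ (b ∷ q) = (a + b) ∷ (p +ₚ q)

  -ₚ_ : Poly → Poly
  -ₚ p = map -_ p

  infixr 7 _·ₚ_
  _·ₚ_ : Carrier → Poly → Poly
  a ·ₚ p = map (a *_) p

  infixl 7 _*ₚ_
  _*ₚ_ : Poly → Poly → Poly
  []      *ₚ q = []
  (a ∷ p) *ₚ q = a ·ₚ q +ₚ (0# ∷ p *ₚ q)

  const : Carrier → Poly
  const a = a ∷ []

  X : Poly
  X = 0# ∷ 1# ∷ []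

  private
    open CommutativeSemigroupProperties +-commutativeSemigroup
      using (x∙yz≈y∙xz) renaming (interchange to +-interchange)

    ≈-refl : ∀ {p} → p ≈ₚ p
    ≈-refl k = refl

    ≈-sym : ∀ {p q} → p ≈ₚ q → q ≈ₚ p
    ≈-sym e k = sym (e k)

    ≈-trans : ∀ {p q r} → p ≈ₚ q → q ≈ₚ r → p ≈ₚ r
    ≈-trans e f k = trans (e k) (f k)

  coeff-+ : ∀ p q k → coeff (p +ₚ q) k ≈ coeff p k + coeff q k
  coeff-+ []      q       k       = sym (+-identityˡ _)
  coeff-+ (a ∷ p) []      k       = sym (+-identityʳ _)
  coeff-+ (a ∷ p) (b ∷ q) zero    = refl
  coeff-+ (a ∷ p) (b ∷ q) (suc k) = coeff-+ p q k

  coeff-· : ∀ a p k → coeff (a ·ₚ p) k ≈ a * coeff p k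
  coeff-· a []      k       = sym (zeroʳ a)
  coeff-· a (b ∷ p) zero    = refl
  coeff-· a (b ∷ p) (suc k) = coeff-· a p k

  private
    neg0 : - 0# ≈ 0#
    neg0 = trans (sym (+-identityˡ _)) (-‿inverseʳ 0#)

  coeff-neg : ∀ p k → coeff (-ₚ p) k ≈ - coeff p k
  coeff-neg []      k       = sym neg0
  coeff-neg (a ∷ p) zero    = refl
  coeff-neg (a ∷ p) (suc k) = coeff-neg p k

  private
    ∷-cong : ∀ {a b p q} → a ≈ b → p ≈ₚ q → a ∷ p ≈ₚ b ∷ q
    ∷-cong e f zero    = e
    ∷-cong e f (suc k) = f k

    0∷[] : 0# ∷ [] ≈ₚ []
    0∷[] zero    = refl
    0∷[] (suc k) = refl

    +-cong′ : ∀ {p q r s} → p ≈ₚ q → r ≈ₚ s → p +ₚ r ≈ₚ q +ₚ s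
    +-cong′ {p} {q} {r} {s} e f k =
      trans (coeff-+ p r k) (trans (+-cong (e k) (f k)) (sym (coeff-+ q s k)))

    +-comm′ : ∀ p q → p +ₚ q ≈ₚ q +ₚ p
    +-comm′ p q k = trans (coeff-+ p q k) (trans (+-comm _ _) (sym (coeff-+ q p k)))

    +-assoc′ : ∀ p q r → (p +ₚ q) +ₚ r ≈ₚ p +ₚ (q +ₚ r)
    +-assoc′ p q r k =
      trans (coeff-+ (p +ₚ q) r k) (trans (+-congʳ (coeff-+ p q k))
      (trans (+-assoc _ _ _)
      (sym (trans (coeff-+ p (q +ₚ r) k) (+-congˡ (coeff-+ q r k))))))

    +-identityʳ′ : ∀ p → p +ₚ [] ≈ₚ p
    +-identityʳ′ p = +-comm′ p []

    inverseʳ′ : ∀ p → p +ₚ (-ₚ p) ≈ₚ []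
    inverseʳ′ p k =
      trans (coeff-+ p (-ₚ p) k) (trans (+-congˡ (coeff-neg p k)) (-‿inverseʳ _))

    -‿cong′ : ∀ {p q} → p ≈ₚ q → -ₚ p ≈ₚ -ₚ q
    -‿cong′ {p} {q} e k = trans (coeff-neg p k) (trans (-‿cong (e k)) (sym (coeff-neg q k)))

    ·-cong : ∀ a {p q} → p ≈ₚ q → a ·ₚ p ≈ₚ a ·ₚ q
    ·-cong a {p} {q} e k = trans (coeff-· a p k) (trans (*-congˡ (e k)) (sym (coeff-· a q k)))

    ·-distrib : ∀ a p q → a ·ₚ (p +ₚ q) ≈ₚ a ·ₚ p +ₚ a ·ₚ q
    ·-distrib a p q k =
      trans (coeff-· a (p +ₚ q) k) (trans (*-congˡ (coeff-+ p q k))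
      (trans (distribˡ _ _ _)
      (sym (trans (coeff-+ (a ·ₚ p) (a ·ₚ q) k) (+-cong (coeff-· a p k) (coeff-· a q k))))))

    ·-assoc : ∀ a b p → (a * b) ·ₚ p ≈ₚ a ·ₚ (b ·ₚ p)
    ·-assoc a b p k =
      trans (coeff-· (a * b) p k) (trans (*-assoc _ _ _)
      (sym (trans (coeff-· a (b ·ₚ p) k) (*-congˡ (coeff-· b p k)))))

    0· : ∀ p → 0# ·ₚ p ≈ₚ []
    0· p k = trans (coeff-· 0# p k) (zeroˡ _)

    1· : ∀ p → 1# ·ₚ p ≈ₚ p
    1· p k = trans (coeff-· 1# p k) (*-identityˡ _)

    interchange : ∀ p q r s → (p +ₚ q) +ₚ (r +ₚ s) ≈ₚ (p +ₚ r) +ₚ (q +ₚ s)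
    interchange p q r s k =
      trans (expand p q r s) (trans (+-interchange _ _ _ _) (sym (expand p r q s)))
      where
      expand : ∀ p q r s → coeff ((p +ₚ q) +ₚ (r +ₚ s)) k ≈
               (coeff p k + coeff q k) + (coeff r k + coeff s k)
      expand p q r s = trans (coeff-+ (p +ₚ q) (r +ₚ s) k)
                             (+-cong (coeff-+ p q k) (coeff-+ r s k))

    0∷-distrib : ∀ p q → 0# ∷ (p +ₚ q) ≈ₚ (0# ∷ p) +ₚ (0# ∷ q)
    0∷-distrib p q = ∷-cong (sym (+-identityˡ 0#)) (≈-refl {p +ₚ q})

    *-congˡ′ : ∀ p {q r} → q ≈ₚ r → p *ₚ q ≈ₚ p *ₚ r
    *-congˡ′ []      e k = refl
    *-congˡ′ (a ∷ p) {q} {r} e =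
      +-cong′ {a ·ₚ q} {a ·ₚ r} {0# ∷ p *ₚ q} {0# ∷ p *ₚ r}
        (·-cong a {q} {r} e) (∷-cong refl (*-congˡ′ p {q} {r} e))

    *-zeroʳ′ : ∀ p → p *ₚ [] ≈ₚ []
    *-zeroʳ′ []      k = refl
    *-zeroʳ′ (a ∷ p)   = ≈-trans {0# ∷ p *ₚ []} {0# ∷ []} {[]} (∷-cong refl (*-zeroʳ′ p)) 0∷[]

    distribˡ′ : ∀ p q r → p *ₚ (q +ₚ r) ≈ₚ p *ₚ q +ₚ p *ₚ r
    distribˡ′ []      q r k = refl
    distribˡ′ (a ∷ p) q r   =
      ≈-trans {(a ∷ p) *ₚ (q +ₚ r)}
              {(a ·ₚ q +ₚ a ·ₚ r) +ₚ ((0# ∷ p *ₚ q) +ₚ (0# ∷ p *ₚ r))}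
              {(a ∷ p) *ₚ q +ₚ (a ∷ p) *ₚ r}
        (+-cong′ {a ·ₚ (q +ₚ r)} {a ·ₚ q +ₚ a ·ₚ r}
                 {0# ∷ p *ₚ (q +ₚ r)} {(0# ∷ p *ₚ q) +ₚ (0# ∷ p *ₚ r)}
          (·-distrib a q r)
          (≈-trans {0# ∷ p *ₚ (q +ₚ r)} {0# ∷ (p *ₚ q +ₚ p *ₚ r)}
                   {(0# ∷ p *ₚ q) +ₚ (0# ∷ p *ₚ r)}
            (∷-cong refl (distribˡ′ p q r)) (0∷-distrib (p *ₚ q) (p *ₚ r))))
        (interchange (a ·ₚ q) (a ·ₚ r) (0# ∷ p *ₚ q) (0# ∷ p *ₚ r))

    *-∷ : ∀ q a p → q *ₚ (a ∷ p) ≈ₚ a ·ₚ q +ₚ (0# ∷ q *ₚ p)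
    *-∷ []      a p zero    = refl
    *-∷ []      a p (suc k) = refl
    *-∷ (b ∷ q) a p zero    = +-congʳ (*-comm b a)
    *-∷ (b ∷ q) a p (suc k) =
      trans (coeff-+ (b ·ₚ p) (q *ₚ (a ∷ p)) k)
      (trans (+-congˡ (trans (*-∷ q a p k) (coeff-+ (a ·ₚ q) (0# ∷ q *ₚ p) k)))
      (trans (x∙yz≈y∙xz _ _ _)
      (sym (trans (coeff-+ (a ·ₚ q) ((b ∷ q) *ₚ p) k)
                  (+-congˡ (coeff-+ (b ·ₚ p) (0# ∷ q *ₚ p) k))))))

    *-comm′ : ∀ p q → p *ₚ q ≈ₚ q *ₚ p
    *-comm′ []      q = ≈-sym {q *ₚ []} {[]} (*-zeroʳ′ q)
    *-comm′ (a ∷ p) q =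
      ≈-trans {(a ∷ p) *ₚ q} {a ·ₚ q +ₚ (0# ∷ q *ₚ p)} {q *ₚ (a ∷ p)}
        (+-cong′ {a ·ₚ q} {a ·ₚ q} {0# ∷ p *ₚ q} {0# ∷ q *ₚ p}
          (≈-refl {a ·ₚ q}) (∷-cong refl (*-comm′ p q)))
        (≈-sym {q *ₚ (a ∷ p)} {a ·ₚ q +ₚ (0# ∷ q *ₚ p)} (*-∷ q a p))

    *-cong′ : ∀ {p q r s} → p ≈ₚ q → r ≈ₚ s → p *ₚ r ≈ₚ q *ₚ s
    *-cong′ {p} {q} {r} {s} e f k =
      trans (*-congˡ′ p {r} {s} f k)
      (trans (*-comm′ p s k) (trans (*-congˡ′ s {p} {q} e k) (*-comm′ s q k)))

    distribʳ′ : ∀ p q r → (q +ₚ r) *ₚ p ≈ₚ q *ₚ p +ₚ r *ₚ p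
    distribʳ′ p q r k =
      trans (*-comm′ (q +ₚ r) p k) (trans (distribˡ′ p q r k)
        (+-cong′ {p *ₚ q} {q *ₚ p} {p *ₚ r} {r *ₚ p} (*-comm′ p q) (*-comm′ p r) k))

    0∷-* : ∀ p q → (0# ∷ p) *ₚ q ≈ₚ 0# ∷ p *ₚ q
    0∷-* p q = +-cong′ {0# ·ₚ q} {[]} {0# ∷ p *ₚ q} {0# ∷ p *ₚ q}
                 (0· q) (≈-refl {0# ∷ p *ₚ q})

    ·-*-assoc : ∀ a p q → (a ·ₚ p) *ₚ q ≈ₚ a ·ₚ (p *ₚ q)
    ·-*-assoc a []      q k = refl
    ·-*-assoc a (b ∷ p) q k =
      trans (+-cong′ {(a * b) ·ₚ q} {a ·ₚ (b ·ₚ q)}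
                     {0# ∷ (a ·ₚ p) *ₚ q} {a ·ₚ (0# ∷ p *ₚ q)}
               (·-assoc a b q) (∷-cong (sym (zeroʳ a)) (·-*-assoc a p q)) k)
            (sym (·-distrib a (b ·ₚ q) (0# ∷ p *ₚ q) k))

    *-assoc′ : ∀ p q r → (p *ₚ q) *ₚ r ≈ₚ p *ₚ (q *ₚ r)
    *-assoc′ []      q r k = refl
    *-assoc′ (a ∷ p) q r k =
      trans (distribʳ′ r (a ·ₚ q) (0# ∷ p *ₚ q) k)
        (+-cong′ {(a ·ₚ q) *ₚ r} {a ·ₚ (q *ₚ r)}
                 {(0# ∷ p *ₚ q) *ₚ r} {0# ∷ p *ₚ (q *ₚ r)}
          (·-*-assoc a q r)
          (≈-trans {(0# ∷ p *ₚ q) *ₚ r} {0# ∷ (p *ₚ q) *ₚ r} {0# ∷ p *ₚ (q *ₚ r)}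
            (0∷-* (p *ₚ q) r) (∷-cong refl (*-assoc′ p q r))) k)

    *-identityˡ′ : ∀ p → const 1# *ₚ p ≈ₚ p
    *-identityˡ′ p k =
      trans (+-cong′ {1# ·ₚ p} {p} {0# ∷ []} {[]} (1· p) 0∷[] k) (+-identityʳ′ p k)

  polynomialRing : CommutativeRing c ℓ
  polynomialRing = record
    { Carrier = Poly
    ; _≈_     = _≈ₚ_
    ; _+_     = _+ₚ_
    ; _*_     = _*ₚ_
    ; -_      = -ₚ_
    ; 0#      = []
    ; 1#      = const 1#
    ; isCommutativeRing = record
      { isRing = record
        { +-isAbelianGroup = record
          { isGroup = record
            { isMonoid = record
              { isSemigroup = record
                { isMagma = record
                  { isEquivalence = record
                    { refl  = λ {p} → ≈-refl {p}
                    ; sym   = λ {p} {q} → ≈-sym {p} {q}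
                    ; trans = λ {p} {q} {r} → ≈-trans {p} {q} {r}
                    }
                  ; ∙-cong = λ {p} {q} {r} {s} → +-cong′ {p} {q} {r} {s}
                  }
                ; assoc = +-assoc′
                }
              ; identity = (λ p → ≈-refl {p}) , +-identityʳ′
              }
            ; inverse = (λ p k → trans (+-comm′ (-ₚ p) p k) (inverseʳ′ p k)) , inverseʳ′
            ; ⁻¹-cong = λ {p} {q} → -‿cong′ {p} {q}
            }
          ; comm = +-comm′
          }
        ; *-cong     = λ {p} {q} {r} {s} → *-cong′ {p} {q} {r} {s}
        ; *-assoc    = *-assoc′
        ; *-identity = *-identityˡ′ , (λ p k → trans (*-comm′ p (const 1#) k) (*-identityˡ′ p k))
        ; distrib    = distribˡ′ , distribʳ′
        }
      ; *-comm = *-comm′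
      }
    }

open Polynomial using (polynomialRing; const; X)

-- For prime l, ℤ/ l is the field 𝔽_l.

ℤ/_ : ℕ → CommutativeRing 0ℓ 0ℓ
ℤ/ m = ℤₚ.+-*-commutativeRing /⟨ + m ⟩

infix 4 _≡_[mod_]
_≡_[mod_] : ℤ → ℤ → ℕ → Set
a ≡ b [mod m ] = CommutativeRing._≈_ (ℤ/ m) a b

infix 4 _≡?_[mod_]
_≡?_[mod_] : ∀ a b m → Dec (a ≡ b [mod m ])
a ≡? b [mod m ] =
  map′ (λ (Signed.divides q e) → q , ≡.sym e)
       (λ (q , e) → Signed.divides q (≡.sym e))
       (+ m Signed.∣? (a ℤ.- b))

φ : ℕ → ℕ
φ n = length (filter (λ k → coprime? k n) (applyUpTo suc n))

-- d = ord_m(k).  The order exists only when k is coprime to m, so it is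
-- a relation rather than a function.

record IsOrder (m : ℕ) (k : ℤ) (d : ℕ) : Set where
  field
    positive : 0 ℕ.< d
    power    : k ℤ.^ d ≡ + 1 [mod m ]
    minimal  : ∀ e → 0 ℕ.< e → k ℤ.^ e ≡ + 1 [mod m ] → d ℕ.≤ e

IsPrimitiveRoot : ℕ → ℤ → Set
IsPrimitiveRoot m g = IsOrder m g (φ m)

-- Fin n is the set of residues modulo n.

CyclotomicCoset : (n l : ℕ) → ℤ → Pred (Fin n) 0ℓ
CyclotomicCoset n l γ α = ∃ λ (r : ℕ) → γ ℤ.* (+ l) ℤ.^ r ≡ + toℕ α [mod n ]

-- Decidability lets χ below sum over each residue of the coset once.
-- Membership is decidable because, by the pigeonhole principle, exponents
-- below n already reach the whole coset.

private
  module _ (n l : ℕ) .{{_ : ℕ.NonZero n}} (γ : ℤ) where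
    private module M = CommutativeRing (ℤ/ n)

    residue : ℤ → Fin n
    residue x = fromℕ< (n%ℕd<d x n)

    ≡residue : ∀ x → x ≡ + (x %ℕ n) [mod n ]
    ≡residue x = (x /ℕ n) , ≡.sym (begin
      x ℤ.- + (x %ℕ n)
        ≡⟨ ≡.cong (ℤ._- + (x %ℕ n)) (a≡a%ℕn+[a/ℕn]*n x n) ⟩
      + (x %ℕ n) ℤ.+ (x /ℕ n) ℤ.* + n ℤ.- + (x %ℕ n)
        ≡⟨ ≡.cong (ℤ._- + (x %ℕ n)) (ℤₚ.+-comm (+ (x %ℕ n)) ((x /ℕ n) ℤ.* + n)) ⟩
      (x /ℕ n) ℤ.* + n ℤ.+ + (x %ℕ n) ℤ.- + (x %ℕ n)
        ≡⟨ ℤₚ.+-assoc ((x /ℕ n) ℤ.* + n) (+ (x %ℕ n)) _ ⟩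
      (x /ℕ n) ℤ.* + n ℤ.+ (+ (x %ℕ n) ℤ.- + (x %ℕ n))
        ≡⟨ ≡.cong (λ z → (x /ℕ n) ℤ.* + n ℤ.+ z) (ℤₚ.+-inverseʳ (+ (x %ℕ n))) ⟩
      (x /ℕ n) ℤ.* + n ℤ.+ ℤ.0ℤ
        ≡⟨ ℤₚ.+-identityʳ _ ⟩
      (x /ℕ n) ℤ.* + n ∎)
      where open ≡.≡-Reasoning

    residue-injective : ∀ x y → residue x ≡ residue y → x ≡ y [mod n ]
    residue-injective x y e =
      M.trans {x} {+ (x %ℕ n)} {y} (≡residue x)
        (≡.subst (λ k → + k ≡ y [mod n ])
          (≡.sym (fromℕ<-injective _ _ (n%ℕd<d x n) (n%ℕd<d y n) e))
          (M.sym {y} {+ (y %ℕ n)} (≡residue y)))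

    orbit : ℕ → ℤ
    orbit r = γ ℤ.* (+ l) ℤ.^ r

    orbit-+ : ∀ a c → orbit (a ℕ.+ c) ≡ orbit a ℤ.* (+ l) ℤ.^ c
    orbit-+ a c = ≡.trans (≡.cong (γ ℤ.*_) (ℤₚ.^-distribˡ-+-* (+ l) a c))
                          (≡.sym (ℤₚ.*-assoc γ ((+ l) ℤ.^ a) ((+ l) ℤ.^ c)))

    orbit-shift : ∀ a b c → orbit a ≡ orbit b [mod n ] →
                  orbit (a ℕ.+ c) ≡ orbit (b ℕ.+ c) [mod n ]
    orbit-shift a b c e = ≡.subst₂ (λ x y → x ≡ y [mod n ])
      (≡.sym (orbit-+ a c)) (≡.sym (orbit-+ b c))
      (M.*-cong {orbit a} {orbit b} {(+ l) ℤ.^ c} {(+ l) ℤ.^ c}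
        e (M.refl {(+ l) ℤ.^ c}))

    bound : ∀ α r → orbit r ≡ α [mod n ] →
            ∃ λ r′ → r′ ℕ.< n × orbit r′ ≡ α [mod n ]
    bound α = <-rec _ step
      where
      step : ∀ r →
             (∀ {k} → k ℕ.< r → orbit k ≡ α [mod n ] →
               ∃ λ r′ → r′ ℕ.< n × orbit r′ ≡ α [mod n ]) →
             orbit r ≡ α [mod n ] → ∃ λ r′ → r′ ℕ.< n × orbit r′ ≡ α [mod n ]
      step r rec e with r ℕₚ.<? n
      ... | yes r<n = r , r<n , e
      ... | no  r≮n
        with i , j , i<j , eq ← pigeonhole (ℕₚ.n<1+n n) (λ k → residue (orbit (toℕ k)))
        = rec k<r (M.trans {orbit k} {orbit r} {α} shifted e)
        where
        j≤r : toℕ j ℕ.≤ r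
        j≤r = ℕₚ.≤-trans (ℕₚ.≤-pred (toℕ<n j)) (ℕₚ.≮⇒≥ r≮n)
        k : ℕ
        k = toℕ i ℕ.+ (r ℕ.∸ toℕ j)
        k<r : k ℕ.< r
        k<r = ≡.subst (k ℕ.<_) (ℕₚ.m+[n∸m]≡n j≤r) (ℕₚ.+-monoˡ-< (r ℕ.∸ toℕ j) i<j)
        shifted : orbit k ≡ orbit r [mod n ]
        shifted = ≡.subst (λ m → orbit k ≡ orbit m [mod n ]) (ℕₚ.m+[n∸m]≡n j≤r)
          (orbit-shift (toℕ i) (toℕ j) (r ℕ.∸ toℕ j)
            (residue-injective (orbit (toℕ i)) (orbit (toℕ j)) eq))

cyclotomicCoset? : ∀ n l γ → Decidable (CyclotomicCoset n l γ)
cyclotomicCoset? n@(suc _) l γ α =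
  map′ (λ (r , _ , e) → r , e)
       (λ (r , e) → bound n l γ (+ toℕ α) r e)
       (ℕₚ.anyUpTo? (λ r → γ ℤ.* (+ l) ℤ.^ r ≡? + toℕ α [mod n ]) n)

-- cyclicAlgebra n l is 𝔽_l[x]/⟨xⁿ - 1⟩; scalar k is the integer k read in 𝔽_l,
-- as a constant polynomial.

module _ (n l : ℕ) where
  private
    𝔽[x] : CommutativeRing 0ℓ 0ℓ
    𝔽[x] = polynomialRing (ℤ/ l)

  cyclicAlgebra : CommutativeRing 0ℓ 0ℓ
  cyclicAlgebra = 𝔽[x] /⟨ X (ℤ/ l) ^ n - 1# ⟩
    where
    open CommutativeRing 𝔽[x] using (_-_; 1#; semiring)
    open Exp semiring using (_^_)

  scalar : ℕ → CommutativeRing.Carrier cyclicAlgebra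
  scalar k = const (ℤ/ l) (+ k)

  χ : ℤ → CommutativeRing.Carrier cyclicAlgebra
  χ γ =
    foldr _+_ 0# (map (λ α → X (ℤ/ l) ^ toℕ α) (filter (cyclotomicCoset? n l γ) (allFin n)))
    where
    open CommutativeRing cyclicAlgebra using (_+_; 0#; semiring)
    open Exp semiring using (_^_)

{-# OPTIONS --safe #-}
module Submission where

-- Since the orders φ(p^s)/2 and φ(q^t) of l are coprime, every integer x ≡ 1 (mod p q) is a power of
-- l modulo n: modulo p^s, the p^(s-1) powers of l^((p-1)/2) exhaust the classes ≡ 1 (mod p), and
-- likewise for q.  For β in the second coset and α = p^i q^j u l^r in the first, α + β is
-- p^i q^j u l^r x with such an x, so translation by β permutes the first coset and x^β fixes its
-- generating sum.  The product is therefore that sum times the size of the second coset, which is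
-- the order of l modulo p^(s-i′) q^(t-j′).

open import Defs
open import Algebra.Bundles using (CommutativeRing)
open import Algebra.Definitions.RawMagma using (_,_)
import Algebra.Properties.AbelianGroup as AbelianGroupProperties
import Algebra.Properties.Semiring.Exp as Exp
open import Data.Fin.Base as Fin using (Fin; toℕ; fromℕ<; punchOut)
open import Data.Fin.Properties
  using (pigeonhole; toℕ<n; punchOut-injective; toℕ-fromℕ<; toℕ-injective)
open import Data.Integer.Base as ℤ using (ℤ; +_; 1ℤ)
open import Data.Integer.DivMod using (_%ℕ_; _/ℕ_; n%ℕd<d; a≡a%ℕn+[a/ℕn]*n)
import Data.Integer.Divisibility.Signed as ℤ∣
import Data.Integer.Properties as ℤₚ
open import Data.Integer.Tactic.RingSolver using (solve-∀)
open import Data.List.Base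
  using (List; []; _∷_; [_]; _++_; length; filter; allFin; applyUpTo; map; foldr)
open import Data.List.Membership.Propositional using (_∈_)
open import Data.List.Membership.Propositional.Properties
  using (∈-filter⁺; ∈-filter⁻; ∈-map⁺; ∈-map⁻; ∈-applyUpTo⁺; ∈-applyUpTo⁻; ∈-allFin)
open import Data.List.Membership.Propositional.Properties.WithK using (unique∧set⇒bag)
open import Data.List.Properties
  using (length-applyUpTo; applyUpTo-∷ʳ; filter-++; length-++; filter-accept; filter-reject; filter-≐)
open import Data.List.Relation.Binary.BagAndSetEquality using (∼bag⇒↭)
open import Data.List.Relation.Binary.Permutation.Propositional using (_↭_; ↭⇒↭ₛ′)
open import Data.List.Relation.Binary.Permutation.Propositional.Properties using (map⁺; ↭-length)
import Data.List.Relation.Binary.Permutation.Setoid.Properties as ↭ₛ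
open import Data.List.Relation.Unary.Any using (here; there)
open import Data.List.Relation.Unary.Unique.Propositional using (Unique)
import Data.List.Relation.Unary.Unique.Propositional.Properties as Unique
open import Data.Nat.Base as ℕ using (ℕ; zero; suc; NonZero; _≤_; _<_; _/_; _%_)
open import Data.Nat.Coprimality as Coprimality
  using (Coprime; coprime?; coprime-divisor; coprime-Bézout; prime⇒coprime)
open import Data.Nat.Divisibility as ∣ using (_∣_; _∤_; divides; _∣?_)
open import Data.Nat.DivMod using (m≡m%n+[m/n]*n; m%n<n; m*n/n≡m)
open import Data.Nat.GCD as GCD using (gcd; gcd-greatest)
open import Data.Nat.Primality
  using (Prime; prime⇒nonZero; prime⇒nonTrivial; prime⇒irreducible; ¬prime[0])
import Data.Nat.Properties as ℕₚ
import Data.Nat.Tactic.RingSolver as ℕ-solver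
open import Data.Product.Base using (∃; ∃₂; _×_; _,_; proj₁; proj₂)
open import Data.Sum.Base using (inj₁; inj₂)
open import Function.Bundles using (mk⇔)
open import Relation.Binary.PropositionalEquality
  using (_≡_; _≢_; refl; sym; trans; cong; cong₂; subst; subst₂; module ≡-Reasoning)
open import Relation.Nullary using (¬_; ¬?; contradiction)
open import Relation.Unary using (Pred; Decidable)

open Polynomial using (X)
private module ℤ+ = AbelianGroupProperties ℤₚ.+-0-abelianGroup

-- The two orders are coprime because p ≡ 3 (mod 4) makes (p - 1)/2, and with it φ(p^s)/2, odd,
-- while a common divisor of φ(p^s)/2 and φ(q^t) divides the gcd 2. The strict inequalities i < i′
-- and j < j′ put the factor p q into β/(p^i q^j): if v inverts u l^r modulo n, the multiplier is x
-- = 1 + v β/(p^i q^j), which is 1 modulo p q. The orders of l are given only modulo p^s and q^t,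
-- whereas the size of the second coset depends on smaller powers. The descent rests on two facts:
-- modulo p only 1 has a p-power equal to 1, and a p-th power improves a congruence to 1 by one
-- factor p. All products in (i) and (ii) are one computation, with generators p^i q^j u and p^i′
-- q^j′ u′ where u and u′ are 1 or g.

private variable
  a b k x y : ℤ
  d d′ m n p : ℕ

-- Coprimality

-- Bézout's identity in ℕ, with the sign of its coefficients prescribed.
coprime⇒inverse : .{{NonZero m}} → .{{NonZero n}} → Coprime m n →
                  ∃₂ λ x y → x ℕ.* m ≡ 1 ℕ.+ y ℕ.* n
coprime⇒inverse {suc m} {suc n} c with coprime-Bézout c
... | GCD.Bézout.+- x y e = x , y , sym e
-- Here the inverse is -x. Multiplying x by the modulus minus 1 replaces the sign, and the extra
-- summand `suc n` keeps the other coefficient natural even for modulus 1.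
... | GCD.Bézout.-+ x y e = x ℕ.* n ℕ.+ suc n , y ℕ.* n ℕ.+ m , (begin
  (x ℕ.* n ℕ.+ suc n) ℕ.* suc m                ≡⟨ lemma₁ m n x ⟩
  n ℕ.* (1 ℕ.+ x ℕ.* suc m) ℕ.+ (1 ℕ.+ m ℕ.* suc n) ≡⟨ cong (λ z → n ℕ.* z ℕ.+ (1 ℕ.+ m ℕ.* suc n)) e ⟩
  n ℕ.* (y ℕ.* suc n) ℕ.+ (1 ℕ.+ m ℕ.* suc n)  ≡⟨ lemma₂ m n y ⟩
  1 ℕ.+ (y ℕ.* n ℕ.+ m) ℕ.* suc n              ∎)
  where
  open ≡-Reasoning
  lemma₁ : ∀ m n x → (x ℕ.* n ℕ.+ suc n) ℕ.* suc m ≡ n ℕ.* (1 ℕ.+ x ℕ.* suc m) ℕ.+ (1 ℕ.+ m ℕ.* suc n)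
  lemma₁ = ℕ-solver.solve-∀
  lemma₂ : ∀ m n y → n ℕ.* (y ℕ.* suc n) ℕ.+ (1 ℕ.+ m ℕ.* suc n) ≡ 1 ℕ.+ (y ℕ.* n ℕ.+ m) ℕ.* suc n
  lemma₂ = ℕ-solver.solve-∀

coprime-* : Coprime m d → Coprime n d → Coprime (m ℕ.* n) d
coprime-* m⊥d n⊥d (e∣mn , e∣d) =
  n⊥d (coprime-divisor (λ { (f∣e , f∣m) → m⊥d (f∣m , ∣.∣-trans f∣e e∣d) }) e∣mn , e∣d)

coprime-^ : ∀ e → Coprime m d → Coprime (m ℕ.^ e) d
coprime-^ zero    _   = Coprimality.1-coprimeTo _
coprime-^ (suc e) m⊥d = coprime-* m⊥d (coprime-^ e m⊥d)

∤⇒coprime : ∀ {p k} → Prime p → p ∤ k → Coprime p k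
∤⇒coprime P p∤k (e∣p , e∣k) with prime⇒irreducible P e∣p
... | inj₁ e≡1  = e≡1
... | inj₂ refl = contradiction e∣k p∤k

odd⇒coprime-2 : ∀ k → Coprime (1 ℕ.+ k ℕ.* 2) 2
odd⇒coprime-2 k {e} (e∣ , e∣2) = ∣.∣1⇒≡1
  (∣.∣m+n∣m⇒∣n (subst (e ∣_) (ℕₚ.+-comm 1 (k ℕ.* 2)) e∣) (∣.∣n⇒∣m*n k e∣2))

distinct-primes⇒coprime : ∀ {p q} → Prime p → Prime q → p ≢ q → Coprime p q
distinct-primes⇒coprime {p} P Q p≢q = ∤⇒coprime P p∤q
  where
  p∤q : p ∤ _
  p∤q p∣q with prime⇒irreducible Q p∣q
  ... | inj₁ p≡1 = ℕ.nonTrivial⇒≢1 {{prime⇒nonTrivial P}} p≡1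
  ... | inj₂ p≡q = p≢q p≡q

coprime-∣ : ∀ {a b c d} → a ∣ c → b ∣ d → Coprime c d → Coprime a b
coprime-∣ a∣c b∣d c⊥d (e∣a , e∣b) = c⊥d (∣.∣-trans e∣a a∣c , ∣.∣-trans e∣b b∣d)

-- Congruences

infix 4 _≈[_]_
infix 5 _by_
-- Equivalent to a ≡ b [mod m ], but a and b can be inferred from the type.
record _≈[_]_ (a : ℤ) (m : ℕ) (b : ℤ) : Set where
  constructor _by_
  field
    quotient : ℤ
    equality : a ≡ b ℤ.+ quotient ℤ.* + m

mod⇒≈ : a ≡ b [mod m ] → a ≈[ m ] b
mod⇒≈ {a} {b} {m} (k , e) = k by (begin
  a                   ≡⟨ lemma a b ⟩
  b ℤ.+ (a ℤ.- b)     ≡⟨ cong (λ z → b ℤ.+ z) e ⟨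
  b ℤ.+ k ℤ.* + m     ∎)
  where
  open ≡-Reasoning
  lemma : ∀ a b → a ≡ b ℤ.+ (a ℤ.- b)
  lemma = solve-∀

≈⇒mod : a ≈[ m ] b → a ≡ b [mod m ]
≈⇒mod {m = m} {b = b} (k by refl) = k , lemma b (k ℤ.* + m)
  where
  lemma : ∀ b x → x ≡ b ℤ.+ x ℤ.- b
  lemma = solve-∀

≈-reflexive : a ≡ b → a ≈[ m ] b
≈-reflexive {a} refl = ℤ.0ℤ by sym (ℤₚ.+-identityʳ a)

≈-refl : a ≈[ m ] a
≈-refl = ≈-reflexive refl

≈-sym : a ≈[ m ] b → b ≈[ m ] a
≈-sym {m = m} {b} (k by refl) = ℤ.- k by lemma b k (+ m)
  where
  lemma : ∀ b k m → b ≡ b ℤ.+ k ℤ.* m ℤ.+ ℤ.- k ℤ.* m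
  lemma = solve-∀

≈-trans : a ≈[ m ] b → b ≈[ m ] x → a ≈[ m ] x
≈-trans {m = m} {x = c} (k by refl) (j by refl) = j ℤ.+ k by lemma c j k (+ m)
  where
  lemma : ∀ c j k m → c ℤ.+ j ℤ.* m ℤ.+ k ℤ.* m ≡ c ℤ.+ (j ℤ.+ k) ℤ.* m
  lemma = solve-∀

≈-+-cong : a ≈[ m ] b → x ≈[ m ] y → a ℤ.+ x ≈[ m ] b ℤ.+ y
≈-+-cong {m = m} {b} {y = d} (k by refl) (j by refl) = k ℤ.+ j by lemma b d k j (+ m)
  where
  lemma : ∀ b d k j m → b ℤ.+ k ℤ.* m ℤ.+ (d ℤ.+ j ℤ.* m) ≡ b ℤ.+ d ℤ.+ (k ℤ.+ j) ℤ.* m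
  lemma = solve-∀

≈-*-cong : a ≈[ m ] b → x ≈[ m ] y → a ℤ.* x ≈[ m ] b ℤ.* y
≈-*-cong {m = m} {b} {y = d} (k by refl) (j by refl) =
  b ℤ.* j ℤ.+ k ℤ.* d ℤ.+ k ℤ.* + m ℤ.* j by lemma b d k j (+ m)
  where
  lemma : ∀ b d k j m → (b ℤ.+ k ℤ.* m) ℤ.* (d ℤ.+ j ℤ.* m) ≡
          b ℤ.* d ℤ.+ (b ℤ.* j ℤ.+ k ℤ.* d ℤ.+ k ℤ.* m ℤ.* j) ℤ.* m
  lemma = solve-∀

≈-*-congˡ : ∀ c → a ≈[ m ] b → c ℤ.* a ≈[ m ] c ℤ.* b
≈-*-congˡ c e = ≈-*-cong (≈-refl {c}) e

≈-^-cong : ∀ e → a ≈[ m ] b → a ℤ.^ e ≈[ m ] b ℤ.^ e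
≈-^-cong zero    _ = ≈-refl
≈-^-cong (suc e) h = ≈-*-cong h (≈-^-cong e h)

≈1⇒^≈1 : ∀ e → a ≈[ m ] 1ℤ → a ℤ.^ e ≈[ m ] 1ℤ
≈1⇒^≈1 e h = ≈-trans (≈-^-cong e h) (≈-reflexive (ℤₚ.^-zeroˡ e))

≈-weaken : m ∣ n → a ≈[ n ] b → a ≈[ m ] b
≈-weaken {m} {b = b} (divides j refl) (k by refl) = k ℤ.* + j by
  cong (λ z → b ℤ.+ z) (trans (cong (k ℤ.*_) (ℤₚ.pos-* j m)) (sym (ℤₚ.*-assoc k (+ j) (+ m))))

≈-scale : ∀ k → a ≈[ m ] b → + k ℤ.* a ≈[ k ℕ.* m ] + k ℤ.* b
≈-scale {m = m} {b} k (j by refl) = j by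
  trans (lemma (+ k) b j (+ m)) (cong (λ z → + k ℤ.* b ℤ.+ j ℤ.* z) (sym (ℤₚ.pos-* k m)))
  where
  lemma : ∀ k b j m → k ℤ.* (b ℤ.+ j ℤ.* m) ≡ k ℤ.* b ℤ.+ j ℤ.* (k ℤ.* m)
  lemma = solve-∀

≈-unscale : ∀ k .{{_ : NonZero k}} → + k ℤ.* a ≈[ k ℕ.* m ] + k ℤ.* b → a ≈[ m ] b
≈-unscale {a} {m} {b} k@(suc _) (j by e) = j by ℤₚ.*-cancelˡ-≡ (+ k) _ _
  (trans e (trans (cong (λ z → + k ℤ.* b ℤ.+ j ℤ.* z) (ℤₚ.pos-* k m)) (lemma (+ k) b j (+ m))))
  where
  lemma : ∀ k b j m → k ℤ.* b ℤ.+ j ℤ.* (k ℤ.* m) ≡ k ℤ.* (b ℤ.+ j ℤ.* m)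
  lemma = solve-∀

-- Once a = b + k m, the second congruence says that n divides m k, hence k.
≈-crt : Coprime m n → a ≈[ m ] b → a ≈[ n ] b → a ≈[ m ℕ.* n ] b
≈-crt {m} {n} {b = b} c (k by refl) (j by e) = combine (coprime-divisor-ℤ n∣mk)
  where
  n∣mk : + n ℤ∣.∣ + m ℤ.* k
  n∣mk = ℤ∣.divides j (trans (ℤₚ.*-comm (+ m) k) (ℤ+.∙-cancelˡ b _ _ e))
  coprime-divisor-ℤ : + n ℤ∣.∣ + m ℤ.* k → + n ℤ∣.∣ k
  coprime-divisor-ℤ h = ℤ∣.∣ᵤ⇒∣ (coprime-divisor (Coprimality.sym c)
    (subst (n ∣_) (ℤₚ.abs-* (+ m) k) (ℤ∣.∣⇒∣ᵤ h)))
  combine : + n ℤ∣.∣ k → b ℤ.+ k ℤ.* + m ≈[ m ℕ.* n ] b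
  combine (ℤ∣.divides i refl) = i by cong (λ z → b ℤ.+ z)
    (trans (lemma i (+ n) (+ m)) (cong (i ℤ.*_) (sym (ℤₚ.pos-* m n))))
    where
    lemma : ∀ i n m → i ℤ.* n ℤ.* m ≡ i ℤ.* (m ℤ.* n)
    lemma = solve-∀

-- Residues

residue : ∀ n .{{_ : NonZero n}} → ℤ → Fin n
residue n x = fromℕ< (n%ℕd<d x n)

≈residue : ∀ n .{{_ : NonZero n}} x → x ≈[ n ] + toℕ (residue n x)
≈residue n x = (x /ℕ n) by
  subst (λ r → x ≡ + r ℤ.+ (x /ℕ n) ℤ.* + n)
    (sym (toℕ-fromℕ< (n%ℕd<d x n))) (a≡a%ℕn+[a/ℕn]*n x n)

residue-injective : ∀ .{{_ : NonZero n}} x y → residue n x ≡ residue n y → x ≈[ n ] y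
residue-injective {n} x y e =
  ≈-trans (≈residue n x) (≈-sym (subst (λ r → y ≈[ n ] + toℕ r) (sym e) (≈residue n y)))

small-≈⇒≡ : ∀ {i j} → i ℕ.< n → j ℕ.< n → + i ≈[ n ] + j → i ≡ j
small-≈⇒≡ {n} {i} {j} i<n j<n (k by e) = ℤₚ.+-injective (ℤₚ.i-j≡0⇒i≡j (+ i) (+ j)
  (ℤₚ.∣i∣≡0⇒i≡0 (trans (cong ℤ.∣_∣ (ℤₚ.m-n≡m⊖n i j)) (vanish ∣i-j∣<n n∣i-j))))
  where
  vanish : ∀ {r} → r ℕ.< n → n ∣ r → r ≡ 0
  vanish {zero}  _   _   = refl
  vanish {suc r} r<n n∣r = contradiction n∣r (∣.>⇒∤ r<n)
  ∣i-j∣<n : ℤ.∣ i ℤ.⊖ j ∣ ℕ.< n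
  ∣i-j∣<n = ℕₚ.≤-<-trans (ℤₚ.∣m⊝n∣≤m⊔n i j) (ℕₚ.⊔-lub i<n j<n)
  lemma : ∀ j x → j ℤ.+ x ℤ.- j ≡ x
  lemma = solve-∀
  n∣i-j : n ∣ ℤ.∣ i ℤ.⊖ j ∣
  n∣i-j = divides ℤ.∣ k ∣ (trans (cong ℤ.∣_∣ (trans (sym (ℤₚ.m-n≡m⊖n i j))
    (trans (cong (λ z → z ℤ.- + j) e) (lemma (+ j) (k ℤ.* + n))))) (ℤₚ.abs-* k (+ n)))

toℕ-≈-injective : ∀ (α β : Fin n) → + toℕ α ≈[ n ] + toℕ β → α ≡ β
toℕ-≈-injective α β h = toℕ-injective (small-≈⇒≡ (toℕ<n α) (toℕ<n β) h)

residue-unique : .{{_ : NonZero n}} → ∀ x (α : Fin n) → x ≈[ n ] + toℕ α → residue n x ≡ α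
residue-unique {n} x α h = toℕ-≈-injective _ α (≈-trans (≈-sym (≈residue n x)) h)

-- Units

Unit : ℕ → ℤ → Set
Unit m a = ∃ λ v → v ℤ.* a ≈[ m ] 1ℤ

unit-1 : Unit m 1ℤ
unit-1 = 1ℤ , ≈-refl

unit-* : Unit m a → Unit m b → Unit m (a ℤ.* b)
unit-* {m} {a} {b} (v , va) (w , wb) = v ℤ.* w ,
  ≈-trans (≈-reflexive (lemma v w a b)) (≈-*-cong va wb)
  where
  lemma : ∀ v w a b → v ℤ.* w ℤ.* (a ℤ.* b) ≡ v ℤ.* a ℤ.* (w ℤ.* b)
  lemma = solve-∀

unit-^ : ∀ e → Unit m a → Unit m (a ℤ.^ e)
unit-^ zero    _ = unit-1
unit-^ (suc e) u = unit-* u (unit-^ e u)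

^≈1⇒unit : ∀ e .{{_ : NonZero e}} → a ℤ.^ e ≈[ m ] 1ℤ → Unit m a
^≈1⇒unit {a} (suc e) h = a ℤ.^ e , ≈-trans (≈-reflexive (ℤₚ.*-comm (a ℤ.^ e) a)) h

≈-*-cancelˡ : Unit m a → a ℤ.* x ≈[ m ] a ℤ.* y → x ≈[ m ] y
≈-*-cancelˡ {m} {a} {x} {y} (v , va) e =
  ≈-trans (≈-sym (cancel x)) (≈-trans (≈-*-congˡ v e) (cancel y))
  where
  cancel : ∀ z → v ℤ.* (a ℤ.* z) ≈[ m ] z
  cancel z = ≈-trans (≈-reflexive (sym (ℤₚ.*-assoc v a z)))
    (≈-trans (≈-*-cong va ≈-refl) (≈-reflexive (ℤₚ.*-identityˡ z)))

^-difference : Unit m a → ∀ i e → a ℤ.^ i ≈[ m ] a ℤ.^ (i ℕ.+ e) → a ℤ.^ e ≈[ m ] 1ℤ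
^-difference {m} {a} u i e h = ≈-*-cancelˡ (unit-^ i u)
  (≈-trans (≈-reflexive (sym (ℤₚ.^-distribˡ-+-* a i e)))
  (≈-trans (≈-sym h) (≈-reflexive (sym (ℤₚ.*-identityʳ (a ℤ.^ i))))))

-- Multiplicative orders

-- Divisibility instead of minimality is the form that passes easily to powers of k, to smaller
-- prime powers and to products of moduli.
record HasOrder (m : ℕ) (k : ℤ) (d : ℕ) : Set where
  field
    power   : k ℤ.^ d ≈[ m ] 1ℤ
    divisor : ∀ e → k ℤ.^ e ≈[ m ] 1ℤ → d ∣ e
open HasOrder

^-multiple : d ∣ n → k ℤ.^ d ≈[ m ] 1ℤ → k ℤ.^ n ≈[ m ] 1ℤ
^-multiple {d} {k = k} (divides e refl) h = ≈-trans
  (≈-reflexive (trans (cong (k ℤ.^_) (ℕₚ.*-comm e d)) (sym (ℤₚ.^-*-assoc k d e))))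
  (≈1⇒^≈1 e h)

isOrder⇒hasOrder : IsOrder m k d → HasOrder m k d
isOrder⇒hasOrder {m} {k} {d} o = record
  { power   = mod⇒≈ (IsOrder.power o)
  ; divisor = λ e h → ∣.m%n≡0⇒n∣m e d (remainder e h)
  }
  where
  instance d≢0 = ℕ.>-nonZero (IsOrder.positive o)
  remainder : ∀ e → k ℤ.^ e ≈[ m ] 1ℤ → e % d ≡ 0
  remainder e h with e % d in eq
  ... | zero    = refl
  ... | r@(suc _) = contradiction (IsOrder.minimal o r ℕ.z<s (≈⇒mod k^r≈1))
                      (ℕₚ.<⇒≱ (subst (ℕ._< d) eq (m%n<n e d)))
    where
    k^r≈1 : k ℤ.^ r ≈[ m ] 1ℤ
    k^r≈1 = ≈-trans
      (≈-trans (≈-reflexive (sym (ℤₚ.*-identityʳ (k ℤ.^ r))))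
        (≈-*-congˡ (k ℤ.^ r) (≈-sym (^-multiple (divides (e / d) refl) (mod⇒≈ (IsOrder.power o))))))
      (≈-trans (≈-reflexive (trans (sym (ℤₚ.^-distribˡ-+-* k r (e / d ℕ.* d)))
        (cong (k ℤ.^_) (trans (cong (ℕ._+ e / d ℕ.* d) (sym eq)) (sym (m≡m%n+[m/n]*n e d)))))) h)

hasOrder⇒unit : .{{_ : NonZero d}} → HasOrder m k d → Unit m k
hasOrder⇒unit o = ^≈1⇒unit _ (power o)

^-injective-≤ : .{{_ : NonZero d}} → HasOrder m k d → ∀ {i j} → i ℕ.≤ j → j ℕ.< d →
                k ℤ.^ i ≈[ m ] k ℤ.^ j → i ≡ j
^-injective-≤ o {i} i≤j j<d h with ℕₚ.m≤n⇒∃[o]m+o≡n i≤j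
... | zero  , refl = sym (ℕₚ.+-identityʳ i)
... | suc e , refl = contradiction (divisor o _ (^-difference (hasOrder⇒unit o) i _ h))
                       (∣.>⇒∤ (ℕₚ.≤-<-trans (ℕₚ.m≤n+m (suc e) i) j<d))

^-injective : .{{_ : NonZero d}} → HasOrder m k d → ∀ {i j} → i ℕ.< d → j ℕ.< d →
              k ℤ.^ i ≈[ m ] k ℤ.^ j → i ≡ j
^-injective o {i} {j} i<d j<d h with ℕₚ.≤-total i j
... | inj₁ i≤j = ^-injective-≤ o i≤j j<d h
... | inj₂ j≤i = sym (^-injective-≤ o j≤i i<d (≈-sym h))

hasOrder-^ : ∀ d .{{_ : NonZero d}} → HasOrder m k (d ℕ.* n) → HasOrder m (k ℤ.^ d) n
hasOrder-^ {k = k} {n} d o = record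
  { power   = ≈-trans (≈-reflexive (ℤₚ.^-*-assoc k d n)) (power o)
  ; divisor = λ e h → ∣.*-cancelˡ-∣ d (divisor o (d ℕ.* e)
                (≈-trans (≈-reflexive (sym (ℤₚ.^-*-assoc k d e))) h))
  }

hasOrder-* : Coprime m n → Coprime d d′ → HasOrder m k d → HasOrder n k d′ →
             HasOrder (m ℕ.* n) k (d ℕ.* d′)
hasOrder-* {m} {n} {d} {d′} {k} m⊥n d⊥d′ o o′ = record
  { power   = ≈-crt m⊥n (^-multiple {d} {k = k} (∣.m∣m*n d′) (power o))
                        (^-multiple {d′} {k = k} (∣.n∣m*n d) (power o′))
  ; divisor = λ e h → product∣ (divisor o e (≈-weaken (∣.m∣m*n n) h))
                               (divisor o′ e (≈-weaken (∣.n∣m*n m) h))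
  }
  where
  product∣ : ∀ {e} → d ∣ e → d′ ∣ e → d ℕ.* d′ ∣ e
  product∣ (divides q refl) d′∣qd = subst (_∣ q ℕ.* d) (ℕₚ.*-comm d′ d)
    (∣.*-monoˡ-∣ d (coprime-divisor (Coprimality.sym d⊥d′) (subst (d′ ∣_) (ℕₚ.*-comm q d) d′∣qd)))

-- Exhausting the classes congruent to 1

-- Pigeonhole: modulo p N there are N classes ≡ 1 (mod p) and as many distinct powers of y.
powers-exhaust : ∀ N → .{{_ : NonZero p}} .{{_ : NonZero N}} → y ≈[ p ] 1ℤ → HasOrder (p ℕ.* N) y N →
                 ∀ x → x ≈[ p ] 1ℤ → ∃ λ r → x ≈[ p ℕ.* N ] y ℤ.^ r
powers-exhaust {p} {y} N y≈1 o x x≈1 =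
  let i , j , i<j , eq = pigeonhole (ℕₚ.n<1+n N) class in collide i j i<j eq
  where
  -- The class of a = 1 + w p modulo p N is determined by w modulo N.
  index : ∀ {a} → a ≈[ p ] 1ℤ → Fin N
  index (w by _) = residue N w
  index-injective : ∀ {a b} (h : a ≈[ p ] 1ℤ) (h′ : b ≈[ p ] 1ℤ) → index h ≡ index h′ →
                    a ≈[ p ℕ.* N ] b
  index-injective (v by refl) (w by refl) e =
    subst₂ (_≈[ p ℕ.* N ]_)
      (cong (λ z → 1ℤ ℤ.+ z) (ℤₚ.*-comm (+ p) v)) (cong (λ z → 1ℤ ℤ.+ z) (ℤₚ.*-comm (+ p) w))
      (≈-+-cong (≈-refl {1ℤ}) (≈-scale p (residue-injective v w e)))
  -- The N + 1 pigeons are x and the powers of y with exponents below N. Two of these powers cannot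
  -- collide, so x takes part in every collision.
  class : Fin (suc N) → Fin N
  class Fin.zero    = index x≈1
  class (Fin.suc r) = index (≈1⇒^≈1 (toℕ r) y≈1)
  collide : ∀ i j → i Fin.< j → class i ≡ class j → ∃ λ r → x ≈[ p ℕ.* N ] y ℤ.^ r
  collide Fin.zero    (Fin.suc r) _   e = toℕ r , index-injective x≈1 (≈1⇒^≈1 (toℕ r) y≈1) e
  collide (Fin.suc r) (Fin.suc s) r<s e = contradiction
    (^-injective o (toℕ<n r) (toℕ<n s)
      (index-injective (≈1⇒^≈1 (toℕ r) y≈1) (≈1⇒^≈1 (toℕ s) y≈1) e))
    (ℕₚ.<⇒≢ (ℕ.s<s⁻¹ r<s))

-- With u m = 1 + v n, the power y^(u m) is 1 and also equals y (y^n)^v, which is y.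
^-coprime : .{{_ : NonZero m}} → .{{_ : NonZero n}} → Coprime m n →
            y ℤ.^ m ≈[ p ] 1ℤ → y ℤ.^ n ≈[ p ] 1ℤ → y ≈[ p ] 1ℤ
^-coprime {m} {n} {y} {p} m⊥n ym≈1 yn≈1 with u , v , e ← coprime⇒inverse m⊥n =
  ≈-trans (≈-sym y^[1+vn]≈y) (^-multiple (divides u (sym e)) ym≈1)
  where
  y^[1+vn]≈y : y ℤ.^ (1 ℕ.+ v ℕ.* n) ≈[ p ] y
  y^[1+vn]≈y = ≈-trans (≈-*-congˡ y (^-multiple (divides v refl) yn≈1))
    (≈-reflexive (ℤₚ.*-identityʳ y))

-- By pigeonhole y has order below p, hence prime to p.
^prime-power≈1⇒≈1 : Prime p → ∀ s → y ℤ.^ (p ℕ.^ s) ≈[ p ] 1ℤ → y ≈[ p ] 1ℤ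
^prime-power≈1⇒≈1 {p@(suc (suc p-2))} {y} P s h =
  let i , j , i<j , eq = pigeonhole (ℕₚ.n<1+n (suc p-2)) class in conclude i j i<j eq
  where
  instance p^s≢0 = ℕₚ.m^n≢0 p s
  unit : Unit p y
  unit = ^≈1⇒unit (p ℕ.^ s) h
  nonzero : ∀ r → Fin.zero ≢ residue p (y ℤ.^ r)
  nonzero r e with v , h ← unit-^ r unit =
    contradiction
      (ℤ∣.∣⇒∣ᵤ (p∣1 (≈-trans (≈-sym (≈-trans (≈-*-congˡ v y^r≈0) (≈-reflexive (ℤₚ.*-zeroʳ v)))) h)))
      (∣.>⇒∤ (ℕ.s<s ℕ.z<s))
    where
    y^r≈0 : y ℤ.^ r ≈[ p ] ℤ.0ℤ
    y^r≈0 = subst (λ i → y ℤ.^ r ≈[ p ] + toℕ i) (sym e) (≈residue p (y ℤ.^ r))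
    p∣1 : ℤ.0ℤ ≈[ p ] 1ℤ → + p ℤ∣.∣ 1ℤ
    p∣1 0≈1 with k by e ← ≈-sym 0≈1 = ℤ∣.divides k (trans e (ℤₚ.+-identityˡ _))
  -- A unit has no power congruent to 0, so the p powers with exponents below p share p - 1
  -- residues.
  class : Fin p → Fin (suc p-2)
  class r = punchOut (nonzero (toℕ r))
  conclude : ∀ i j → i Fin.< j → class i ≡ class j → y ≈[ p ] 1ℤ
  conclude i j i<j eq with ℕₚ.m≤n⇒∃[o]m+o≡n (ℕₚ.<⇒≤ i<j)
  ... | zero  , e = contradiction (trans (sym (ℕₚ.+-identityʳ (toℕ i))) e) (ℕₚ.<⇒≢ i<j)
  ... | suc d , e = ^-coprime (Coprimality.sym (coprime-^ s (prime⇒coprime P d<p))) y^d≈1 h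
    where
    d<p : suc d ℕ.< p
    d<p = ℕₚ.≤-<-trans (subst (suc d ℕ.≤_) e (ℕₚ.m≤n+m (suc d) (toℕ i))) (toℕ<n j)
    y^d≈1 : y ℤ.^ suc d ≈[ p ] 1ℤ
    y^d≈1 = ^-difference unit (toℕ i) (suc d)
      (subst (λ r → y ℤ.^ toℕ i ≈[ p ] y ℤ.^ r) (sym e)
        (residue-injective _ _ (punchOut-injective (nonzero (toℕ i)) (nonzero (toℕ j)) eq)))

-- Lifting congruences and orders along prime powers

binomial-mod-square : ∀ e z → ∃ λ c → (1ℤ ℤ.+ z) ℤ.^ e ≡ 1ℤ ℤ.+ + e ℤ.* z ℤ.+ z ℤ.* z ℤ.* c
binomial-mod-square zero    z = ℤ.0ℤ , lemma z
  where
  lemma : ∀ z → 1ℤ ≡ 1ℤ ℤ.+ ℤ.0ℤ ℤ.* z ℤ.+ z ℤ.* z ℤ.* ℤ.0ℤ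
  lemma = solve-∀
binomial-mod-square (suc e) z with c , h ← binomial-mod-square e z =
  + e ℤ.+ c ℤ.+ z ℤ.* c ,
  trans (cong ((1ℤ ℤ.+ z) ℤ.*_) h)
  (trans (lemma z (+ e) c)
    (cong (λ f → 1ℤ ℤ.+ f ℤ.* z ℤ.+ z ℤ.* z ℤ.* (+ e ℤ.+ c ℤ.+ z ℤ.* c)) (sym (ℤₚ.pos-+ 1 e))))
  where
  lemma : ∀ z e c → (1ℤ ℤ.+ z) ℤ.* (1ℤ ℤ.+ e ℤ.* z ℤ.+ z ℤ.* z ℤ.* c) ≡
          1ℤ ℤ.+ (1ℤ ℤ.+ e) ℤ.* z ℤ.+ z ℤ.* z ℤ.* (e ℤ.+ c ℤ.+ z ℤ.* c)
  lemma = solve-∀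

-- In the expansion of (1 + w p m)^p the linear term gains a factor p from the exponent, and (p m)^2
-- is already a multiple of p (p m).
^p-lifts : ∀ p m → x ≈[ p ℕ.* m ] 1ℤ → x ℤ.^ p ≈[ p ℕ.* (p ℕ.* m) ] 1ℤ
^p-lifts p m (w by refl) with c , h ← binomial-mod-square p (w ℤ.* + (p ℕ.* m)) =
  w ℤ.+ w ℤ.* w ℤ.* + m ℤ.* c by
  trans h (subst₂ (λ pm ppm → 1ℤ ℤ.+ + p ℤ.* (w ℤ.* pm) ℤ.+ (w ℤ.* pm) ℤ.* (w ℤ.* pm) ℤ.* c ≡
                               1ℤ ℤ.+ (w ℤ.+ w ℤ.* w ℤ.* + m ℤ.* c) ℤ.* ppm)
    (sym pm) (sym (trans (ℤₚ.pos-* p (p ℕ.* m)) (cong (+ p ℤ.*_) pm)))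
    (lemma (+ p) (+ m) w c))
  where
  pm : + (p ℕ.* m) ≡ + p ℤ.* + m
  pm = ℤₚ.pos-* p m
  lemma : ∀ p m w c → 1ℤ ℤ.+ p ℤ.* (w ℤ.* (p ℤ.* m)) ℤ.+ (w ℤ.* (p ℤ.* m)) ℤ.* (w ℤ.* (p ℤ.* m)) ℤ.* c ≡
          1ℤ ℤ.+ (w ℤ.+ w ℤ.* w ℤ.* m ℤ.* c) ℤ.* (p ℤ.* (p ℤ.* m))
  lemma = solve-∀

^p^b-lifts : ∀ p a b → x ≈[ p ℕ.^ suc a ] 1ℤ → x ℤ.^ (p ℕ.^ b) ≈[ p ℕ.^ suc (a ℕ.+ b) ] 1ℤ
^p^b-lifts {x} p a zero    h = subst (λ e → x ℤ.^ 1 ≈[ p ℕ.^ suc e ] 1ℤ) (sym (ℕₚ.+-identityʳ a))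
  (≈-trans (≈-reflexive (ℤₚ.^-identityʳ x)) h)
^p^b-lifts {x} p a (suc b) h = subst₂ (λ y e → y ≈[ p ℕ.^ suc e ] 1ℤ)
  (trans (ℤₚ.^-*-assoc x (p ℕ.^ b) p) (cong (x ℤ.^_) (ℕₚ.*-comm (p ℕ.^ b) p)))
  (sym (ℕₚ.+-suc a b))
  (^p-lifts p (p ℕ.^ (a ℕ.+ b)) (^p^b-lifts p a b h))

module _ (P : Prime p) .{{_ : NonZero d}} where

  private instance
    p≢0 : NonZero p
    p≢0 = prime⇒nonZero P

  -- Modulo p the factor p^s can be stripped from the exponent, since only 1 has a p-power equal to
  -- 1 there.
  hasOrder⇒^d≈1 : ∀ s → HasOrder (p ℕ.^ suc s) k (d ℕ.* p ℕ.^ s) → k ℤ.^ d ≈[ p ] 1ℤ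
  hasOrder⇒^d≈1 {k} s o = ^prime-power≈1⇒≈1 P s
    (≈-weaken (∣.m∣m*n (p ℕ.^ s)) (≈-trans (≈-reflexive (ℤₚ.^-*-assoc k d (p ℕ.^ s))) (power o)))

  -- From k^d ≡ 1 (mod p), taking p-th powers a times reaches the modulus p^(a+1). Conversely, k^e ≡
  -- 1 at that modulus gives k^(e p^b) ≡ 1 at the top one, so d p^(a+b) divides e p^b, and p^b
  -- cancels.
  hasOrder-reduce : ∀ a b → HasOrder (p ℕ.^ suc (a ℕ.+ b)) k (d ℕ.* p ℕ.^ (a ℕ.+ b)) →
                    HasOrder (p ℕ.^ suc a) k (d ℕ.* p ℕ.^ a)
  hasOrder-reduce {k} a b o = record
    { power   = ≈-trans (≈-reflexive (sym (ℤₚ.^-*-assoc k d (p ℕ.^ a))))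
        (^p^b-lifts p 0 a (subst (λ m → k ℤ.^ d ≈[ m ] 1ℤ) (sym (ℕₚ.*-identityʳ p))
          (hasOrder⇒^d≈1 (a ℕ.+ b) o)))
    ; divisor = λ e h → ∣.*-cancelʳ-∣ (p ℕ.^ b) {{ℕₚ.m^n≢0 p b}}
        (subst (_∣ e ℕ.* p ℕ.^ b)
          (trans (cong (d ℕ.*_) (ℕₚ.^-distribˡ-+-* p a b)) (sym (ℕₚ.*-assoc d (p ℕ.^ a) (p ℕ.^ b))))
          (divisor o (e ℕ.* p ℕ.^ b)
            (≈-trans (≈-reflexive (sym (ℤₚ.^-*-assoc k e (p ℕ.^ b)))) (^p^b-lifts p a b h))))
    }

  powers-exhaust-prime-power : ∀ s → HasOrder (p ℕ.^ suc s) k (d ℕ.* p ℕ.^ s) →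
                               ∀ x → x ≈[ p ] 1ℤ → ∃ λ r → x ≈[ p ℕ.^ suc s ] k ℤ.^ r
  powers-exhaust-prime-power {k} s o x x≈1
    with r , h ← powers-exhaust (p ℕ.^ s) {{p≢0}} {{ℕₚ.m^n≢0 p s}}
                   (hasOrder⇒^d≈1 s o) (hasOrder-^ d o) x x≈1 =
    d ℕ.* r , ≈-trans h (≈-reflexive (ℤₚ.^-*-assoc k d r))

-- Chinese remaindering takes place among the exponents, which matter only modulo d on one side and
-- modulo d′ on the other.
powers-exhaust-* : .{{_ : NonZero d}} → .{{_ : NonZero d′}} → Coprime m n → Coprime d d′ →
                   k ℤ.^ d ≈[ m ] 1ℤ → k ℤ.^ d′ ≈[ n ] 1ℤ →
                   ∀ i j → x ≈[ m ] k ℤ.^ i → x ≈[ n ] k ℤ.^ j → ∃ λ r → x ≈[ m ℕ.* n ] k ℤ.^ r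
powers-exhaust-* {d} {d′} {m} {n} {k} {x} m⊥n d⊥d′ kd≈1 kd′≈1 i j xi xj
  with u , v , e ← coprime⇒inverse (Coprimality.sym d⊥d′)
     | u′ , v′ , e′ ← coprime⇒inverse d⊥d′ =
  -- `u * d′` is 1 modulo d and 0 modulo d′; `u′ * d` is the reverse.
  i ℕ.* (u ℕ.* d′) ℕ.+ j ℕ.* (u′ ℕ.* d) , ≈-crt m⊥n
    (≈-trans xi (≈-sym (exponent kd≈1 (i ℕ.* v ℕ.+ j ℕ.* u′)
      (trans (cong (λ z → i ℕ.* z ℕ.+ j ℕ.* (u′ ℕ.* d)) e) (lemma₁ i v j u′ d)))))
    (≈-trans xj (≈-sym (exponent kd′≈1 (j ℕ.* v′ ℕ.+ i ℕ.* u)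
      (trans (cong (λ z → i ℕ.* (u ℕ.* d′) ℕ.+ j ℕ.* z) e′) (lemma₂ i u j v′ d′)))))
  where
  exponent : ∀ {d m i N} → k ℤ.^ d ≈[ m ] 1ℤ → ∀ c → N ≡ i ℕ.+ c ℕ.* d → k ℤ.^ N ≈[ m ] k ℤ.^ i
  exponent {d} {m} {i} h c refl = ≈-trans (≈-reflexive (ℤₚ.^-distribˡ-+-* k i (c ℕ.* d)))
    (≈-trans (≈-*-congˡ (k ℤ.^ i) (^-multiple {d} {k = k} (divides c refl) h))
      (≈-reflexive (ℤₚ.*-identityʳ _)))
  lemma₁ : ∀ i v j u d → i ℕ.* (1 ℕ.+ v ℕ.* d) ℕ.+ j ℕ.* (u ℕ.* d) ≡ i ℕ.+ (i ℕ.* v ℕ.+ j ℕ.* u) ℕ.* d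
  lemma₁ = ℕ-solver.solve-∀
  lemma₂ : ∀ i u j v d → i ℕ.* (u ℕ.* d) ℕ.+ j ℕ.* (1 ℕ.+ v ℕ.* d) ≡ j ℕ.+ (j ℕ.* v ℕ.+ i ℕ.* u) ℕ.* d
  lemma₂ = ℕ-solver.solve-∀

-- Euler’s function at prime powers

module _ {ℓ} {P : Pred ℕ ℓ} (P? : Decidable P) where

  -- In `φ n` both the bound and the predicate depend on n; separating them allows induction on the
  -- bound with the predicate fixed.
  count : ℕ → ℕ
  count n = length (filter P? (applyUpTo suc n))

  private
    count-suc : ∀ n → count (suc n) ≡ count n ℕ.+ length (filter P? [ suc n ])
    count-suc n = begin
      length (filter P? (applyUpTo suc (suc n)))
        ≡⟨ cong (λ ks → length (filter P? ks)) (applyUpTo-∷ʳ suc n) ⟨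
      length (filter P? (applyUpTo suc n ++ [ suc n ]))
        ≡⟨ cong length (filter-++ P? (applyUpTo suc n) [ suc n ]) ⟩
      length (filter P? (applyUpTo suc n) ++ filter P? [ suc n ])
        ≡⟨ length-++ (filter P? (applyUpTo suc n)) ⟩
      count n ℕ.+ length (filter P? [ suc n ]) ∎
      where open ≡-Reasoning

  count-accept : ∀ n → P (suc n) → count (suc n) ≡ suc (count n)
  count-accept n Pn = trans (count-suc n)
    (trans (cong (λ ks → count n ℕ.+ length ks) (filter-accept P? Pn)) (ℕₚ.+-comm (count n) 1))

  count-reject : ∀ n → ¬ P (suc n) → count (suc n) ≡ count n
  count-reject n ¬Pn = trans (count-suc n)
    (trans (cong (λ ks → count n ℕ.+ length ks) (filter-reject P? ¬Pn)) (ℕₚ.+-identityʳ (count n)))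

-- The bound is split into m full blocks of length d + 1 and a remainder r. Each full block ends in
-- its only multiple and contributes d.
count-nonmultiples : ∀ d m r → r ≤ d →
  count (λ k → ¬? (suc d ∣? k)) (r ℕ.+ m ℕ.* suc d) ≡ r ℕ.+ m ℕ.* d
count-nonmultiples d zero    zero    _   = refl
count-nonmultiples d (suc m) zero    _   =
  trans (count-reject _ (d ℕ.+ m ℕ.* suc d) (λ ∤ → ∤ (∣.n∣m*n (suc m))))
        (count-nonmultiples d m d ℕₚ.≤-refl)
count-nonmultiples d m       (suc r) r<d =
  trans (count-accept _ (r ℕ.+ m ℕ.* suc d) indivisible)
        (cong suc (count-nonmultiples d m r (ℕₚ.<⇒≤ r<d)))
  where
  indivisible : suc d ∤ suc r ℕ.+ m ℕ.* suc d
  indivisible h = ∣.>⇒∤ (ℕ.s<s r<d)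
    (∣.∣m+n∣m⇒∣n (subst (suc d ∣_) (ℕₚ.+-comm (suc r) (m ℕ.* suc d)) h) (∣.n∣m*n m))

φ-prime-power : ∀ {p} → Prime p → ∀ a → φ (p ℕ.^ suc a) ≡ ℕ.pred p ℕ.* p ℕ.^ a
φ-prime-power {zero}  P a = contradiction P ¬prime[0]
φ-prime-power {p@(suc p-1)} P a = begin
  φ (p ℕ.^ suc a)
    ≡⟨ cong length (filter-≐ (λ k → coprime? k (p ℕ.^ suc a)) (λ k → ¬? (p ∣? k))
         (coprime⇒∤ , λ p∤k → Coprimality.sym (coprime-^ (suc a) (∤⇒coprime P p∤k)))
         (applyUpTo suc (p ℕ.^ suc a))) ⟩
  count (λ k → ¬? (p ∣? k)) (p ℕ.* p ℕ.^ a)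
    ≡⟨ cong (count (λ k → ¬? (p ∣? k))) (ℕₚ.*-comm p (p ℕ.^ a)) ⟩
  count (λ k → ¬? (p ∣? k)) (p ℕ.^ a ℕ.* p)
    ≡⟨ count-nonmultiples p-1 (p ℕ.^ a) 0 ℕ.z≤n ⟩
  p ℕ.^ a ℕ.* p-1
    ≡⟨ ℕₚ.*-comm (p ℕ.^ a) p-1 ⟩
  p-1 ℕ.* p ℕ.^ a ∎
  where
  open ≡-Reasoning
  coprime⇒∤ : ∀ {k} → Coprime k (p ℕ.^ suc a) → p ∤ k
  coprime⇒∤ c p∣k = ℕ.nonTrivial⇒≢1 {{prime⇒nonTrivial P}} (c (p∣k , ∣.m∣m*n (p ℕ.^ a)))

-- Set equality of duplicate-free lists becomes a permutation, which serves both to measure a coset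
-- and to reorder its sum.
unique∧⊆∧⊇⇒↭ : ∀ {a} {A : Set a} {xs ys : List A} → Unique xs → Unique ys →
               (∀ {x} → x ∈ xs → x ∈ ys) → (∀ {x} → x ∈ ys → x ∈ xs) → xs ↭ ys
unique∧⊆∧⊇⇒↭ uxs uys xs⊆ys ys⊆xs = ∼bag⇒↭ (unique∧set⇒bag uxs uys (mk⇔ xs⊆ys ys⊆xs))

-- Sums of powers of an n-th root of unity

module PowerSums {c ℓ} (R : CommutativeRing c ℓ) (n : ℕ) .{{_ : NonZero n}}
  (x : CommutativeRing.Carrier R)
  (xⁿ≈1 : CommutativeRing._≈_ R (Exp._^_ (CommutativeRing.semiring R) x n) (CommutativeRing.1# R))
  where

  open CommutativeRing R hiding (refl; sym; trans)
  open Exp semiring using (_^_; ^-homo-*; ^-assocʳ; ^-congˡ)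

  private module R = CommutativeRing R
  open import Relation.Binary.Reasoning.Setoid setoid

  powerSum : List (Fin n) → Carrier
  powerSum αs = foldr _+_ 0# (map (λ α → x ^ toℕ α) αs)

  1^ : ∀ k → 1# ^ k ≈ 1#
  1^ zero    = R.refl
  1^ (suc k) = R.trans (*-identityˡ _) (1^ k)

  ^-% : ∀ k → x ^ (k % n) ≈ x ^ k
  ^-% k = R.sym (begin
    x ^ k                             ≡⟨ cong (x ^_) (m≡m%n+[m/n]*n k n) ⟩
    x ^ (k % n ℕ.+ k / n ℕ.* n)       ≈⟨ ^-homo-* x (k % n) (k / n ℕ.* n) ⟩
    x ^ (k % n) * x ^ (k / n ℕ.* n)   ≡⟨ cong (λ e → x ^ (k % n) * x ^ e) (ℕₚ.*-comm (k / n) n) ⟩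
    x ^ (k % n) * x ^ (n ℕ.* (k / n)) ≈⟨ *-congˡ (^-assocʳ x n (k / n)) ⟨
    x ^ (k % n) * (x ^ n) ^ (k / n)   ≈⟨ *-congˡ (^-congˡ (k / n) xⁿ≈1) ⟩
    x ^ (k % n) * 1# ^ (k / n)        ≈⟨ *-congˡ (1^ (k / n)) ⟩
    x ^ (k % n) * 1#                  ≈⟨ *-identityʳ _ ⟩
    x ^ (k % n)                       ∎)

  powerSum-↭ : ∀ {αs βs} → αs ↭ βs → powerSum αs ≈ powerSum βs
  powerSum-↭ p = ↭ₛ.foldr-commMonoid setoid +-isCommutativeMonoid
    (↭⇒↭ₛ′ isEquivalence (map⁺ (λ α → x ^ toℕ α) p))

  shift : Fin n → Fin n → Fin n
  shift β α = fromℕ< (m%n<n (toℕ α ℕ.+ toℕ β) n)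

  powerSum-shift : ∀ αs β → powerSum αs * x ^ toℕ β ≈ powerSum (map (shift β) αs)
  powerSum-shift []       β = zeroˡ _
  powerSum-shift (α ∷ αs) β = begin
    (x ^ toℕ α + powerSum αs) * x ^ toℕ β              ≈⟨ distribʳ _ _ _ ⟩
    x ^ toℕ α * x ^ toℕ β + powerSum αs * x ^ toℕ β    ≈⟨ +-cong x^α*x^β (powerSum-shift αs β) ⟩
    x ^ toℕ (shift β α) + powerSum (map (shift β) αs)  ∎
    where
    x^α*x^β : x ^ toℕ α * x ^ toℕ β ≈ x ^ toℕ (shift β α)
    x^α*x^β = begin
      x ^ toℕ α * x ^ toℕ β           ≈⟨ ^-homo-* x (toℕ α) (toℕ β) ⟨
      x ^ (toℕ α ℕ.+ toℕ β)           ≈⟨ ^-% (toℕ α ℕ.+ toℕ β) ⟨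
      x ^ ((toℕ α ℕ.+ toℕ β) % n)     ≡⟨ cong (x ^_) (toℕ-fromℕ< (m%n<n (toℕ α ℕ.+ toℕ β) n)) ⟨
      x ^ toℕ (shift β α)             ∎

  -- Each x^β fixes the first sum, so every entry of βs contributes one copy of it. `ι` is the
  -- reading of naturals in the ring, given by its recursion so that `scalar` can take its place.
  powerSum-* : (ι : ℕ → Carrier) → ι 0 ≈ 0# → (∀ k → ι (suc k) ≈ 1# + ι k) →
               ∀ αs βs → (∀ {β} → β ∈ βs → map (shift β) αs ↭ αs) →
               powerSum αs * powerSum βs ≈ ι (length βs) * powerSum αs
  powerSum-* ι ι0 ιsuc αs []       _      = R.trans (zeroʳ _) (R.sym (R.trans (*-congʳ ι0) (zeroˡ _)))
  powerSum-* ι ι0 ιsuc αs (β ∷ βs) stable = begin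
    powerSum αs * (x ^ toℕ β + powerSum βs)                ≈⟨ distribˡ _ _ _ ⟩
    powerSum αs * x ^ toℕ β + powerSum αs * powerSum βs    ≈⟨ +-cong
      (R.trans (powerSum-shift αs β) (powerSum-↭ (stable (here refl))))
      (powerSum-* ι ι0 ιsuc αs βs (λ β∈βs → stable (there β∈βs))) ⟩
    powerSum αs + ι (length βs) * powerSum αs              ≈⟨ +-congʳ (*-identityˡ _) ⟨
    1# * powerSum αs + ι (length βs) * powerSum αs         ≈⟨ distribʳ _ _ _ ⟨
    (1# + ι (length βs)) * powerSum αs                     ≈⟨ *-congʳ (ιsuc (length βs)) ⟨
    ι (suc (length βs)) * powerSum αs                      ∎

-- Cyclotomic cosets

module _ (n l : ℕ) .{{_ : NonZero n}} where

  -- Arbitrary integers are allowed here, so that sums and differences can be treated before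
  -- reduction to a residue.
  InCoset : ℤ → ℤ → Set
  InCoset γ a = ∃ λ r → γ ℤ.* (+ l) ℤ.^ r ≈[ n ] a

  inCoset-resp-≈ : ∀ γ → a ≈[ n ] b → InCoset γ a → InCoset γ b
  inCoset-resp-≈ γ e (r , h) = r , ≈-trans h e

  coset : ℤ → List (Fin n)
  coset γ = filter (cyclotomicCoset? n l γ) (allFin n)

  coset-unique : ∀ γ → Unique (coset γ)
  coset-unique γ = Unique.filter⁺ (cyclotomicCoset? n l γ) (Unique.allFin⁺ n)

  ∈-coset⁺ : ∀ γ {α} → InCoset γ (+ toℕ α) → α ∈ coset γ
  ∈-coset⁺ γ {α} (r , h) = ∈-filter⁺ (cyclotomicCoset? n l γ) (∈-allFin α) (r , ≈⇒mod h)

  ∈-coset⁻ : ∀ γ {α} → α ∈ coset γ → InCoset γ (+ toℕ α)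
  ∈-coset⁻ γ α∈
    with r , h ← proj₂ (∈-filter⁻ (cyclotomicCoset? n l γ) {xs = allFin n} α∈) = r , mod⇒≈ h

  -- As u is invertible modulo m, multiplication by P u embeds the classes modulo m into those
  -- modulo n. Hence P u l^r repeats modulo n exactly when l^r repeats modulo m.
  coset-length : ∀ {P m u d} .{{_ : NonZero P}} .{{_ : NonZero d}} → n ≡ P ℕ.* m → Unit m u →
                 HasOrder m (+ l) d → length (coset (+ P ℤ.* u)) ≡ d
  coset-length {P} {m} {u} {d} refl u-unit o =
    trans (sym (↭-length powers↭coset)) (length-applyUpTo (λ r → residue n (γ ℤ.* (+ l) ℤ.^ r)) d)
    where
    γ = + P ℤ.* u
    scale : ∀ {x y} → x ≈[ m ] y → γ ℤ.* x ≈[ n ] γ ℤ.* y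
    scale {x} {y} h = ≈-trans (≈-reflexive (ℤₚ.*-assoc (+ P) u x))
      (≈-trans (≈-scale P (≈-*-congˡ u h)) (≈-reflexive (sym (ℤₚ.*-assoc (+ P) u y))))
    unscale : ∀ {x y} → γ ℤ.* x ≈[ n ] γ ℤ.* y → x ≈[ m ] y
    unscale {x} {y} h = ≈-*-cancelˡ u-unit (≈-unscale P
      (≈-trans (≈-reflexive (sym (ℤₚ.*-assoc (+ P) u x)))
      (≈-trans h (≈-reflexive (ℤₚ.*-assoc (+ P) u y)))))
    l^r%d≈l^r : ∀ r → (+ l) ℤ.^ (r % d) ≈[ m ] (+ l) ℤ.^ r
    l^r%d≈l^r r = ≈-sym (≈-trans
      (≈-reflexive (trans (cong ((+ l) ℤ.^_) (m≡m%n+[m/n]*n r d)) (ℤₚ.^-distribˡ-+-* (+ l) (r % d) _)))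
      (≈-trans (≈-*-congˡ ((+ l) ℤ.^ (r % d))
        (^-multiple {d} {k = + l} (divides (r / d) refl) (power o))) (≈-reflexive (ℤₚ.*-identityʳ _))))
    powers↭coset : applyUpTo (λ r → residue n (γ ℤ.* (+ l) ℤ.^ r)) d ↭ coset γ
    powers↭coset = unique∧⊆∧⊇⇒↭
      (Unique.applyUpTo⁺₁ _ d (λ i<j j<d e → ℕₚ.<⇒≢ i<j
        (^-injective o (ℕₚ.<-trans i<j j<d) j<d (unscale (residue-injective _ _ e)))))
      (coset-unique γ)
      (λ α∈ → let r , _ , e = ∈-applyUpTo⁻ _ α∈ in
        ∈-coset⁺ γ (r , subst (λ α → γ ℤ.* (+ l) ℤ.^ r ≈[ n ] + toℕ α) (sym e) (≈residue n _)))
      (λ {α} α∈ → let r , h = ∈-coset⁻ γ α∈ in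
        subst (_∈ _) (residue-unique _ α (≈-trans (scale (l^r%d≈l^r r)) h))
          (∈-applyUpTo⁺ _ (m%n<n r d)))

  private
    module R = CommutativeRing (cyclicAlgebra n l)
    module 𝔽[x] = CommutativeRing (Polynomial.polynomialRing (ℤ/ l))
    module 𝔽[x]^ = Exp 𝔽[x].semiring
    module R^ = Exp R.semiring

    -- _^_ takes the equality of the ring as a parameter, so this is not definitional.
    ^-quotient : ∀ f k → f R^.^ k ≡ f 𝔽[x]^.^ k
    ^-quotient f zero    = refl
    ^-quotient f (suc k) = cong (f R.*_) (^-quotient f k)

    Xⁿ≈1 : X (ℤ/ l) R^.^ n R.≈ R.1#
    Xⁿ≈1 = subst (R._≈ R.1#) (sym (^-quotient (X (ℤ/ l)) n))
      (R.1# , 𝔽[x].*-identityˡ (X (ℤ/ l) 𝔽[x]^.^ n 𝔽[x].- 𝔽[x].1#))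

    module Sums = PowerSums (cyclicAlgebra n l) n (X (ℤ/ l)) Xⁿ≈1
  open Sums using (shift)

  -- These two facts are all that is used about l when cosets are translated; h will be p q.
  module _ {h : ℕ} (l-unit : Unit n (+ l))
           (l-exhausts : ∀ x → x ≈[ h ] 1ℤ → ∃ λ r → x ≈[ n ] (+ l) ℤ.^ r) where

    coset-translate : ∀ P {u} → Unit n u → ∀ w {a b} → InCoset (+ P ℤ.* u) a →
                      b ≈[ n ] + P ℤ.* (+ h ℤ.* w) → InCoset (+ P ℤ.* u) (a ℤ.+ b)
    coset-translate P {u} u-unit w {a} {b} (r , γl^r≈a) b≈
      with v , v-inverse ← unit-* u-unit (unit-^ r l-unit)
      -- Since v inverts u l^r, multiplying P u l^r by 1 + v w h adds P h w, which is b.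
      with k , e ← l-exhausts (1ℤ ℤ.+ v ℤ.* w ℤ.* + h) ((v ℤ.* w) by refl) =
      r ℕ.+ k , (≈-trans (≈-reflexive (cong (+ P ℤ.* u ℤ.*_) (ℤₚ.^-distribˡ-+-* (+ l) r k)))
        (≈-trans (≈-*-congˡ (+ P ℤ.* u) (≈-*-congˡ ((+ l) ℤ.^ r) (≈-sym e)))
        (≈-trans (≈-reflexive (lemma (+ P) u ((+ l) ℤ.^ r) v w (+ h)))
        (≈-+-cong γl^r≈a (≈-trans (≈-*-congˡ (+ P ℤ.* (+ h ℤ.* w)) v-inverse)
          (≈-trans (≈-reflexive (ℤₚ.*-identityʳ _)) (≈-sym b≈)))))))
      where
      lemma : ∀ P u L v w h → P ℤ.* u ℤ.* (L ℤ.* (1ℤ ℤ.+ v ℤ.* w ℤ.* h)) ≡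
              P ℤ.* u ℤ.* L ℤ.+ P ℤ.* (h ℤ.* w) ℤ.* (v ℤ.* (u ℤ.* L))
      lemma = solve-∀

    shift≈ : ∀ β α → + toℕ (shift β α) ≈[ n ] + toℕ α ℤ.+ + toℕ β
    shift≈ β α = ≈-sym (≈residue n (+ (toℕ α ℕ.+ toℕ β)))

    coset-shift : ∀ P {u} → Unit n u → ∀ w β → + toℕ β ≈[ n ] + P ℤ.* (+ h ℤ.* w) →
                  map (shift β) (coset (+ P ℤ.* u)) ↭ coset (+ P ℤ.* u)
    coset-shift P {u} u-unit w β β≈ = unique∧⊆∧⊇⇒↭
      (Unique.map⁺ (λ {α} {α′} → shift-injective α α′) (coset-unique γ)) (coset-unique γ)
      (λ α∈ → let α , α∈C , e = ∈-map⁻ (shift β) α∈ in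
        subst (_∈ _) (sym e) (∈-coset⁺ γ (inCoset-resp-≈ γ (≈-sym (shift≈ β α))
          (coset-translate P u-unit w (∈-coset⁻ γ α∈C) β≈))))
      -- The preimage of α is α - β, and -β has the shape required of β with -w for w.
      (λ {α} α∈ → subst (_∈ _) (shift-unshift α) (∈-map⁺ (shift β) (∈-coset⁺ γ
        (inCoset-resp-≈ γ (≈residue n (+ toℕ α ℤ.- + toℕ β))
          (coset-translate P u-unit (ℤ.- w) (∈-coset⁻ γ α∈) -β≈)))))
      where
      γ = + P ℤ.* u
      cancel : ∀ a b → a ℤ.+ b ℤ.- b ≡ a
      cancel = solve-∀
      cancel′ : ∀ a b → a ℤ.- b ℤ.+ b ≡ a
      cancel′ = solve-∀
      shift-injective : ∀ α α′ → shift β α ≡ shift β α′ → α ≡ α′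
      shift-injective α α′ e = toℕ-≈-injective α α′
        (subst₂ (_≈[ n ]_) (cancel (+ toℕ α) (+ toℕ β)) (cancel (+ toℕ α′) (+ toℕ β))
          (≈-+-cong (≈-trans (≈-sym (shift≈ β α))
              (subst (λ σ → + toℕ σ ≈[ n ] + toℕ α′ ℤ.+ + toℕ β) (sym e) (shift≈ β α′)))
            (≈-refl {ℤ.- + toℕ β})))
      shift-unshift : ∀ α → shift β (residue n (+ toℕ α ℤ.- + toℕ β)) ≡ α
      shift-unshift α = toℕ-≈-injective _ α (≈-trans (shift≈ β _)
        (≈-trans (≈-+-cong (≈-sym (≈residue n (+ toℕ α ℤ.- + toℕ β))) (≈-refl {+ toℕ β}))
          (≈-reflexive (cancel′ (+ toℕ α) (+ toℕ β)))))
      neg-lemma : ∀ P h w → ℤ.-1ℤ ℤ.* (P ℤ.* (h ℤ.* w)) ≡ P ℤ.* (h ℤ.* ℤ.- w)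
      neg-lemma = solve-∀
      -β≈ : ℤ.- + toℕ β ≈[ n ] + P ℤ.* (+ h ℤ.* ℤ.- w)
      -β≈ = ≈-trans (≈-reflexive (sym (ℤₚ.-1*i≡-i (+ toℕ β))))
        (≈-trans (≈-*-congˡ ℤ.-1ℤ β≈) (≈-reflexive (neg-lemma (+ P) (+ h) w)))

    χ-product : ∀ {γ δ P c m d u u′} .{{_ : NonZero (P ℕ.* (h ℕ.* c))}} .{{_ : NonZero d}} →
                n ≡ P ℕ.* (h ℕ.* c) ℕ.* m → γ ≡ + P ℤ.* u → δ ≡ + (P ℕ.* (h ℕ.* c)) ℤ.* u′ →
                Unit n u → Unit n u′ → HasOrder m (+ l) d →
                χ n l γ R.* χ n l δ R.≈ scalar n l d R.* χ n l γ
    χ-product {P = P} {c} {m} {d} {u} {u′} n≡ refl refl u-unit u′-unit o =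
      subst (λ e → χ n l γ R.* χ n l δ R.≈ scalar n l e R.* χ n l γ)
        (coset-length n≡
          (proj₁ u′-unit , ≈-weaken (divides (P ℕ.* (h ℕ.* c)) n≡) (proj₂ u′-unit)) o)
        (Sums.powerSum-* (scalar n l) ι0 (λ k → R.refl {scalar n l (suc k)}) (coset γ) (coset δ)
          (λ {β} β∈ → let r , e = ∈-coset⁻ δ β∈ in
            -- An element of the second coset is P h c u′ l^r, so w = c u′ l^r.
            coset-shift P u-unit (+ c ℤ.* (u′ ℤ.* (+ l) ℤ.^ r)) β
              (≈-trans (≈-sym e) (≈-reflexive
                (trans (cong (λ z → z ℤ.* u′ ℤ.* (+ l) ℤ.^ r) Phc)
                       (lemma (+ P) (+ h) (+ c) u′ ((+ l) ℤ.^ r)))))))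
      where
      γ = + P ℤ.* u
      δ = + (P ℕ.* (h ℕ.* c)) ℤ.* u′
      ι0 : scalar n l 0 R.≈ R.0#
      -- `scalar n l 0` is a list with the single entry 0 and `R.0#` is the empty list; their
      -- difference is the zero multiple of the generator.
      ι0 = [] , λ { zero → F.refl {ℤ.0ℤ} ; (suc _) → F.refl {ℤ.0ℤ} }
        where
        module F = CommutativeRing (ℤ/ l)
      Phc : + (P ℕ.* (h ℕ.* c)) ≡ + P ℤ.* (+ h ℤ.* + c)
      Phc = trans (ℤₚ.pos-* P (h ℕ.* c)) (cong (+ P ℤ.*_) (ℤₚ.pos-* h c))
      lemma : ∀ P h c u L → P ℤ.* (h ℤ.* c) ℤ.* u ℤ.* L ≡ P ℤ.* (h ℤ.* (c ℤ.* (u ℤ.* L)))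
      lemma = solve-∀

-- Specialisation to n = p^s q^t

module _ {c ℓ} (R : CommutativeRing c ℓ) where
  private module R = CommutativeRing R

  common-value : ∀ x y z → x R.≈ z → y R.≈ z → (x R.≈ y) × (y R.≈ z)
  common-value _ _ _ x≈z y≈z = R.trans x≈z (R.sym y≈z) , y≈z

^-split : ∀ p {i s} → i ≤ s → p ℕ.^ s ≡ p ℕ.^ i ℕ.* p ℕ.^ (s ℕ.∸ i)
^-split p {i} {s} i≤s =
  trans (cong (p ℕ.^_) (sym (ℕₚ.m+[n∸m]≡n i≤s))) (ℕₚ.^-distribˡ-+-* p i (s ℕ.∸ i))

module PrimePowers {s t p q l : ℕ}
  (P : Prime p) (Q : Prime q) (p≢q : p ≢ q) (p≡3[4] : p % 4 ≡ 3)
  (order-pˢ : HasOrder (p ℕ.^ suc s) (+ l) (φ (p ℕ.^ suc s) / 2))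
  (order-qᵗ : HasOrder (q ℕ.^ suc t) (+ l) (φ (q ℕ.^ suc t)))
  (gcd≡2 : gcd (φ (p ℕ.^ suc s)) (φ (q ℕ.^ suc t)) ≡ 2)
  where

  private
    instance
      p≢0 : NonZero p
      p≢0 = prime⇒nonZero P
      q≢0 : NonZero q
      q≢0 = prime⇒nonZero Q
      q-1≢0 : NonZero (ℕ.pred q)
      q-1≢0 = ℕ.>-nonZero (ℕ.s<s⁻¹ (subst (1 <_) (sym (ℕₚ.suc-pred q))
        (ℕ.nonTrivial⇒n>1 q {{prime⇒nonTrivial Q}})))

    p^≢0 : ∀ a → NonZero (p ℕ.^ a)
    p^≢0 a = ℕₚ.m^n≢0 p a

    q^≢0 : ∀ b → NonZero (q ℕ.^ b)
    q^≢0 b = ℕₚ.m^n≢0 q b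

    -- This is (p - 1)/2 for p ≡ 3 (mod 4), written so that it is visibly odd; it is not the modulus
    -- h of the coset lemmas.
    h : ℕ
    h = 1 ℕ.+ p / 4 ℕ.* 2

    p≡1+2h : p ≡ suc (h ℕ.* 2)
    p≡1+2h = trans (m≡m%n+[m/n]*n p 4) (trans (cong (ℕ._+ p / 4 ℕ.* 4) p≡3[4]) (lemma (p / 4)))
      where
      lemma : ∀ k → 3 ℕ.+ k ℕ.* 4 ≡ suc ((1 ℕ.+ k ℕ.* 2) ℕ.* 2)
      lemma = ℕ-solver.solve-∀

    φ-p : ∀ a → φ (p ℕ.^ suc a) ≡ h ℕ.* p ℕ.^ a ℕ.* 2
    φ-p a = trans (φ-prime-power P a)
      (trans (cong (λ r → ℕ.pred r ℕ.* p ℕ.^ a) p≡1+2h) (lemma h (p ℕ.^ a)))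
      where
      lemma : ∀ h m → h ℕ.* 2 ℕ.* m ≡ h ℕ.* m ℕ.* 2
      lemma = ℕ-solver.solve-∀

    φ-p/2 : ∀ a → φ (p ℕ.^ suc a) / 2 ≡ h ℕ.* p ℕ.^ a
    φ-p/2 a = trans (cong (_/ 2) (φ-p a)) (m*n/n≡m (h ℕ.* p ℕ.^ a) 2)

    φ-p/2≢0 : ∀ a → NonZero (φ (p ℕ.^ suc a) / 2)
    φ-p/2≢0 a = subst NonZero (sym (φ-p/2 a)) (ℕₚ.m*n≢0 h (p ℕ.^ a) {{_}} {{p^≢0 a}})

    φ-q≢0 : ∀ b → NonZero (φ (q ℕ.^ b))
    φ-q≢0 zero    = _
    φ-q≢0 (suc b) = subst NonZero (sym (φ-prime-power Q b))
      (ℕₚ.m*n≢0 (ℕ.pred q) (q ℕ.^ b) {{q-1≢0}} {{q^≢0 b}})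

    order-n≢0 : ∀ a b → NonZero (φ (p ℕ.^ suc a) / 2 ℕ.* φ (q ℕ.^ b))
    order-n≢0 a b = ℕₚ.m*n≢0 _ _ {{φ-p/2≢0 a}} {{φ-q≢0 b}}

    N : ℕ
    N = p ℕ.^ suc s ℕ.* q ℕ.^ suc t

    instance
      n≢0 : NonZero N
      n≢0 = ℕₚ.m*n≢0 (p ℕ.^ suc s) (q ℕ.^ suc t) {{p^≢0 (suc s)}} {{q^≢0 (suc t)}}

    prime-powers-coprime : ∀ a b → Coprime (p ℕ.^ a) (q ℕ.^ b)
    prime-powers-coprime a b = coprime-^ a (Coprimality.sym
      (coprime-^ b (Coprimality.sym (distinct-primes⇒coprime P Q p≢q))))

    order-p : ∀ a b → a ℕ.+ b ≡ s → HasOrder (p ℕ.^ suc a) (+ l) (φ (p ℕ.^ suc a) / 2)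
    order-p a b refl = subst (HasOrder _ _) (sym (φ-p/2 a))
      (hasOrder-reduce {d = h} P a b (subst (HasOrder _ _) (φ-p/2 (a ℕ.+ b)) order-pˢ))

    order-q : ∀ b → b ≤ suc t → HasOrder (q ℕ.^ b) (+ l) (φ (q ℕ.^ b))
    -- The case j′ = t: the modulus is 1 and φ(1) = 1 is the order.
    order-q zero    _           = record
      { power   = ((+ l) ℤ.^ 1 ℤ.- 1ℤ) by lemma ((+ l) ℤ.^ 1)
      ; divisor = λ e _ → ∣.1∣ e
      }
      where
      lemma : ∀ x → x ≡ 1ℤ ℤ.+ (x ℤ.- 1ℤ) ℤ.* 1ℤ
      lemma = solve-∀
    order-q (suc b) (ℕ.s≤s b≤t) with c , refl ← ℕₚ.m≤n⇒∃[o]m+o≡n b≤t =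
      subst (HasOrder _ _) (sym (φ-prime-power Q b))
        (hasOrder-reduce {d = ℕ.pred q} Q b c
          (subst (HasOrder _ _) (φ-prime-power Q (b ℕ.+ c)) order-qᵗ))

    -- φ(p^s)/2 = h p^(s-1) is odd.
    orders-coprime : Coprime (φ (p ℕ.^ suc s) / 2) (φ (q ℕ.^ suc t))
    orders-coprime {e} (e∣φp/2 , e∣φq) =
      coprime-* (odd⇒coprime-2 (p / 4)) (coprime-^ s p⊥2) (subst (e ∣_) (φ-p/2 s) e∣φp/2 , e∣2)
      where
      p⊥2 : Coprime p 2
      p⊥2 = subst (λ r → Coprime r 2) (sym p≡1+2h) (odd⇒coprime-2 h)
      e∣φp : e ∣ φ (p ℕ.^ suc s)
      e∣φp = subst (e ∣_) (trans (cong (ℕ._* 2) (φ-p/2 s)) (sym (φ-p s))) (∣.∣m⇒∣m*n 2 e∣φp/2)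
      e∣2 : e ∣ 2
      e∣2 = subst (e ∣_) gcd≡2 (gcd-greatest e∣φp e∣φq)

    l-unit : Unit N (+ l)
    l-unit = hasOrder⇒unit {{order-n≢0 s (suc t)}}
      (hasOrder-* (prime-powers-coprime (suc s) (suc t)) orders-coprime order-pˢ order-qᵗ)

    l-exhausts : ∀ x → x ≈[ p ℕ.* q ] 1ℤ → ∃ λ r → x ≈[ N ] (+ l) ℤ.^ r
    l-exhausts x x≈1 =
      let i , xi = powers-exhaust-prime-power {d = h} P s
                     (subst (HasOrder _ _) (φ-p/2 s) order-pˢ) x (≈-weaken (∣.m∣m*n q) x≈1)
          j , xj = powers-exhaust-prime-power {d = ℕ.pred q} Q t
                     (subst (HasOrder _ _) (φ-prime-power Q t) order-qᵗ) x (≈-weaken (∣.n∣m*n p) x≈1)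
      in powers-exhaust-* {{φ-p/2≢0 s}} {{φ-q≢0 (suc t)}}
           (prime-powers-coprime (suc s) (suc t)) orders-coprime (power order-pˢ) (power order-qᵗ) i j xi xj

    module _ {i j} (i≤s : i ≤ s) (j≤t : j ≤ suc t) where

      -- This is N / (p^i q^j), the modulus whose order of l is the coset size. A factor p always
      -- remains, as `φ 1 / 2` would round down to 0.
      cofactor : ℕ
      cofactor = p ℕ.^ suc (s ℕ.∸ i) ℕ.* q ℕ.^ (suc t ℕ.∸ j)

      pˢ-split : p ℕ.^ suc s ≡ p ℕ.^ i ℕ.* p ℕ.^ suc (s ℕ.∸ i)
      pˢ-split = trans (cong (p ℕ.*_) (^-split p i≤s)) (lemma p (p ℕ.^ i) (p ℕ.^ (s ℕ.∸ i)))
        where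
        lemma : ∀ a b c → a ℕ.* (b ℕ.* c) ≡ b ℕ.* (a ℕ.* c)
        lemma = ℕ-solver.solve-∀

      n-split : N ≡ p ℕ.^ i ℕ.* q ℕ.^ j ℕ.* cofactor
      n-split = trans (cong₂ ℕ._*_ pˢ-split (^-split q j≤t))
        (lemma (p ℕ.^ i) (p ℕ.^ suc (s ℕ.∸ i)) (q ℕ.^ j) (q ℕ.^ (suc t ℕ.∸ j)))
        where
        lemma : ∀ a b c d → a ℕ.* b ℕ.* (c ℕ.* d) ≡ a ℕ.* c ℕ.* (b ℕ.* d)
        lemma = ℕ-solver.solve-∀

      -- The orders modulo the smaller prime powers divide the full ones, so they inherit
      -- coprimality and multiply.
      hasOrder-cofactor :
        HasOrder cofactor (+ l) (φ (p ℕ.^ suc (s ℕ.∸ i)) / 2 ℕ.* φ (q ℕ.^ (suc t ℕ.∸ j)))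
      hasOrder-cofactor = hasOrder-* (prime-powers-coprime (suc (s ℕ.∸ i)) (suc t ℕ.∸ j))
        (coprime-∣ (divisor oᵖ _ (≈-weaken (divides (p ℕ.^ i) pˢ-split) (power order-pˢ)))
                   (divisor o^q _ (≈-weaken (divides (q ℕ.^ j) (^-split q j≤t)) (power order-qᵗ)))
                   orders-coprime)
        oᵖ o^q
        where
        oᵖ = order-p (s ℕ.∸ i) i (ℕₚ.m∸n+n≡m i≤s)
        o^q = order-q (suc t ℕ.∸ j) (ℕₚ.m∸n≤m (suc t) j)

  private module R = CommutativeRing (cyclicAlgebra N l)

  χ-product-prime-powers : ∀ {i i′ j j′} γ δ u u′ → i < i′ → i′ ≤ s → j < j′ → j′ ≤ suc t →
    γ ≡ + (p ℕ.^ i ℕ.* q ℕ.^ j) ℤ.* u → δ ≡ + (p ℕ.^ i′ ℕ.* q ℕ.^ j′) ℤ.* u′ →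
    Unit N u → Unit N u′ →
    χ N l γ R.* χ N l δ R.≈
      scalar N l (φ (p ℕ.^ (suc s ℕ.∸ i′)) / 2 ℕ.* φ (q ℕ.^ (suc t ℕ.∸ j′))) R.* χ N l γ
  χ-product-prime-powers {i} {i′} {j} {j′} γ δ u u′ i<i′ i′≤s j<j′ j′≤t γ≡ δ≡ u-unit u′-unit =
    subst (λ e → χ N l γ R.* χ N l δ R.≈
                   scalar N l (φ (p ℕ.^ e) / 2 ℕ.* φ (q ℕ.^ (suc t ℕ.∸ j′))) R.* χ N l γ)
      (sym (ℕₚ.+-∸-assoc 1 i′≤s))
      (χ-product N l l-unit l-exhausts
        {P = p ℕ.^ i ℕ.* q ℕ.^ j} {c = c} {m = cofactor i′≤s j′≤t} {u = u} {u′ = u′}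
        {{subst NonZero P′≡ (ℕₚ.m*n≢0 (p ℕ.^ i′) (q ℕ.^ j′) {{p^≢0 i′}} {{q^≢0 j′}})}}
        {{order-n≢0 (s ℕ.∸ i′) (suc t ℕ.∸ j′)}}
        (trans (n-split i′≤s j′≤t) (cong (ℕ._* cofactor i′≤s j′≤t) P′≡))
        γ≡ (trans δ≡ (cong (λ P′ → + P′ ℤ.* u′) P′≡))
        u-unit u′-unit (hasOrder-cofactor i′≤s j′≤t))
    where
    -- One factor p and one factor q are set aside from p^(i′-i) q^(j′-j) to form the p q of
    -- `l-exhausts`.
    c : ℕ
    c = p ℕ.^ (i′ ℕ.∸ suc i) ℕ.* q ℕ.^ (j′ ℕ.∸ suc j)
    P′≡ : p ℕ.^ i′ ℕ.* q ℕ.^ j′ ≡ p ℕ.^ i ℕ.* q ℕ.^ j ℕ.* (p ℕ.* q ℕ.* c)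
    P′≡ = trans (cong₂ ℕ._*_ (^-split p i<i′) (^-split q j<j′))
      (lemma p q (p ℕ.^ i) (p ℕ.^ (i′ ℕ.∸ suc i)) (q ℕ.^ j) (q ℕ.^ (j′ ℕ.∸ suc j)))
      where
      lemma : ∀ p q a b c d → p ℕ.* a ℕ.* b ℕ.* (q ℕ.* c ℕ.* d) ≡ a ℕ.* c ℕ.* (p ℕ.* q ℕ.* (b ℕ.* d))
      lemma = ℕ-solver.solve-∀

  -- The product of the two orders is a common multiple of them, so this power of g is 1 modulo both
  -- prime powers.
  primitiveRoot⇒unit : ∀ {g} → IsPrimitiveRoot (p ℕ.^ suc s) g →
                       IsPrimitiveRoot (q ℕ.^ suc t) g → Unit N g
  primitiveRoot⇒unit {g} gᵖ g^q = ^≈1⇒unit (φ (p ℕ.^ suc s) ℕ.* φ (q ℕ.^ suc t))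
    {{ℕₚ.m*n≢0 _ _ {{ℕ.>-nonZero (IsOrder.positive gᵖ)}} {{ℕ.>-nonZero (IsOrder.positive g^q)}}}}
    (≈-crt (prime-powers-coprime (suc s) (suc t))
      (^-multiple {φ (p ℕ.^ suc s)} {k = g} (∣.m∣m*n (φ (q ℕ.^ suc t))) (mod⇒≈ (IsOrder.power gᵖ)))
      (^-multiple {φ (q ℕ.^ suc t)} {k = g} (∣.n∣m*n (φ (p ℕ.^ suc s))) (mod⇒≈ (IsOrder.power g^q))))

  -- Leaving γ = p^i q^j u general covers (i) with u = 1 and (ii) with u = g; the second factor
  -- takes the units 1 and g in turn.
  χ-products : ∀ {i i′ j j′ g} → i < i′ → i′ ≤ s → j < j′ → j′ ≤ suc t → Unit N g →
    ∀ γ u → γ ≡ + (p ℕ.^ i ℕ.* q ℕ.^ j) ℤ.* u → Unit N u →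
    let δ = + (p ℕ.^ i′ ℕ.* q ℕ.^ j′)
        c = scalar N l (φ (p ℕ.^ (suc s ℕ.∸ i′)) / 2 ℕ.* φ (q ℕ.^ (suc t ℕ.∸ j′)))
    in (χ N l γ R.* χ N l δ R.≈ χ N l γ R.* χ N l (δ ℤ.* g)) ×
       (χ N l γ R.* χ N l (δ ℤ.* g) R.≈ c R.* χ N l γ)
  χ-products {i} {i′} {j} {j′} {g} i<i′ i′≤s j<j′ j′≤t g-unit γ u γ≡ u-unit =
    common-value (cyclicAlgebra N l)
      (χ N l γ R.* χ N l δ) (χ N l γ R.* χ N l (δ ℤ.* g)) (c R.* χ N l γ)
      (χ-product-prime-powers γ δ u 1ℤ i<i′ i′≤s j<j′ j′≤t γ≡ (sym (ℤₚ.*-identityʳ δ)) u-unit unit-1)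
      (χ-product-prime-powers γ (δ ℤ.* g) u g i<i′ i′≤s j<j′ j′≤t γ≡ refl u-unit g-unit)
    where
    δ : ℤ
    δ = + (p ℕ.^ i′ ℕ.* q ℕ.^ j′)
    c : R.Carrier
    c = scalar N l (φ (p ℕ.^ (suc s ℕ.∸ i′)) / 2 ℕ.* φ (q ℕ.^ (suc t ℕ.∸ j′)))

open import Data.Nat.Base using (_*_; _^_; _∸_)

theorem4p6 : (s t p q l : ℕ) (g : ℤ) → 1 ≤ s → 1 ≤ t →
  Prime p → Prime q → Prime l → p ≢ q → p ≢ l → q ≢ l →
  p % 2 ≡ 1 → q % 2 ≡ 1 → p % 4 ≡ 3 →
  IsOrder (p ^ s) (+ l) (φ (p ^ s) / 2) →
  IsOrder (q ^ t) (+ l) (φ (q ^ t)) →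
  gcd (φ (p ^ s)) (φ (q ^ t)) ≡ 2 →
  IsPrimitiveRoot (p ^ s) g → IsPrimitiveRoot (q ^ t) g →
  (i i′ j j′ : ℕ) → i < i′ → i′ ≤ s ∸ 1 → j < j′ → j′ ≤ t →
  let n = p ^ s * q ^ t
      module R = CommutativeRing (cyclicAlgebra n l)
      χᵢⱼ   = λ a b → χ n l (+ (p ^ a * q ^ b))
      χᵢⱼ*  = λ a b → χ n l (+ (p ^ a * q ^ b) ℤ.* g)
      c     = scalar n l (φ (p ^ (s ∸ i′)) / 2 * φ (q ^ (t ∸ j′)))
  in
  ((χᵢⱼ i j R.* χᵢⱼ i′ j′ R.≈ χᵢⱼ i j R.* χᵢⱼ* i′ j′) ×
   (χᵢⱼ i j R.* χᵢⱼ* i′ j′ R.≈ c R.* χᵢⱼ i j)) ×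
  ((χᵢⱼ* i j R.* χᵢⱼ i′ j′ R.≈ χᵢⱼ* i j R.* χᵢⱼ* i′ j′) ×
   (χᵢⱼ* i j R.* χᵢⱼ* i′ j′ R.≈ c R.* χᵢⱼ* i j))
theorem4p6 (suc s) (suc t) p q l g (ℕ.s≤s ℕ.z≤n) (ℕ.s≤s ℕ.z≤n) P Q _ p≢q _ _ _ _ p≡3[4]
  ordᵖ ord^q gcd≡2 gᵖ g^q i i′ j j′ i<i′ i′≤s j<j′ j′≤t =
  products (+ (p ^ i * q ^ j)) 1ℤ (sym (ℤₚ.*-identityʳ _)) unit-1 ,
  products (+ (p ^ i * q ^ j) ℤ.* g) g refl g-unit
  where
  g-unit : Unit (p ^ suc s * q ^ suc t) g
  g-unit = PrimePowers.primitiveRoot⇒unit {s} {t} P Q p≢q p≡3[4]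
    (isOrder⇒hasOrder ordᵖ) (isOrder⇒hasOrder ord^q) gcd≡2 gᵖ g^q
  products = PrimePowers.χ-products {s} {t} P Q p≢q p≡3[4]
    (isOrder⇒hasOrder ordᵖ) (isOrder⇒hasOrder ord^q) gcd≡2 i<i′ i′≤s j<j′ j′≤t g-unit
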